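{- For Any-Strict Undirected Reachability Graph Realizability there is an infinite family $\mathcal{B}$ of simple digraphs such that for every $D=(V,A)\in\mathcal{B}$ with $n=|V|$ and solid graph $G=(V,E)$ the following hold (with the implicit constants uniform over the family): (1) $G$ is planar; (2) $G$ has a feedback vertex set of size $2$ and its minimum feedback edge set has size $\Theta(n)$; (3) $D$ is realizable, and there is an edge $e\in E$ such that every realization of $D$ assigns $\Omega(n)$ labels to $e$.
   Context: An undirected temporal graph is a pair $(G,\lambda)$ with $G=(V,E)$ a simple undirected graph and $\lambda:E\to 2^{\mathbb{N}}$ assigning each edge a finite, possibly empty, set of labels. A strict temporal path from $u$ to $v$ is a sequence $(e_1,t_1),\dots,(e_\ell,t_\ell)$, $t_j\in\lambda(e_j)$, such that $e_1,\dots,e_\ell$ form a $u$-$v$ path and $t_1<\dots<t_\ell$. The strict reachability graph is the digraph on $V$ with arc $(u,v)$, $u\ne v$, iff a strict temporal path from $u$ to $v$ exists. A realization of a simple digraph $D=(V,A)$ (Any-Strict variant) is a labeling $\lambda$ of the solid graph of $D$ such that the strict reachability graph of the resulting undirected temporal graph equals $D$; $D$ is realizable if one exists. A solid edge of $D$ is a pair $\{u,v\}$ with $(u,v),(v,u)\in A$; the solid graph of $D$ is the undirected graph on $V$ formed by the solid edges. -}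

module Defs where

open import Data.Nat using (ℕ; zero; suc; _≤_; _<_; _+_; _*_)
open import Data.Fin using (Fin; toℕ)
open import Data.Bool using (Bool; true; false)
open import Data.List using (List; []; _∷_; _++_; [_]; length)
open import Data.List.Membership.Propositional using (_∈_)
open import Data.List.Relation.Unary.Unique.Propositional using (Unique)
open import Data.List.Relation.Unary.Linked using (Linked)
open import Data.Product using (Σ; ∃; ∃-syntax; _×_; _,_; proj₁; proj₂)
open import Data.Sum using (_⊎_)
open import Relation.Binary.PropositionalEquality using (_≡_; _≢_)
open import Relation.Nullary using (¬_)
open import Data.Rational as ℚ using (ℚ; 0ℚ; 1ℚ)

Digraph : ℕ → Set
Digraph n = Fin n → Fin n → Bool

Arc : ∀ {n} → Digraph n → Fin n → Fin n → Set
Arc D u v = D u v ≡ true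

-- simple digraph: no loops (multi-arcs are impossible in this representation)
SimpleDigraph : ∀ {n} → Digraph n → Set
SimpleDigraph {n} D = (u : Fin n) → D u u ≡ false

Solid : ∀ {n} → Digraph n → Fin n → Fin n → Set
Solid D u v = Arc D u v × Arc D v u

-- Undirected (simple) graphs given by a symmetric adjacency relation

Graph : ℕ → Set₁
Graph n = Fin n → Fin n → Set

consecutive : ∀ {A : Set} → List A → List (A × A)
consecutive []           = []
consecutive (x ∷ [])     = []
consecutive (x ∷ y ∷ xs) = (x , y) ∷ consecutive (y ∷ xs)

record Cycle {n : ℕ} (G : Graph n) : Set where
  field
    start  : Fin n
    rest   : List (Fin n)
    long   : 2 ≤ length rest
    uniq   : Unique (start ∷ rest)
    linked : Linked G (start ∷ rest ++ [ start ])

  vertices : List (Fin n)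
  vertices = start ∷ rest

  edges : List (Fin n × Fin n)
  edges = consecutive (start ∷ rest ++ [ start ])

HasFVS2 : ∀ {n} → Graph n → Set
HasFVS2 {n} G = Σ (Fin n) λ s₁ → Σ (Fin n) λ s₂ → s₁ ≢ s₂ ×
  ((C : Cycle G) → s₁ ∈ Cycle.vertices C ⊎ s₂ ∈ Cycle.vertices C)

-- an edge set of G: a duplicate-free list of edges, each written (u,v)
-- with toℕ u < toℕ v (so each undirected edge has a unique representative)
record EdgeSet {n : ℕ} (G : Graph n) : Set where
  field
    list   : List (Fin n × Fin n)
    uniq   : Unique list
    valid  : ∀ {u v} → (u , v) ∈ list → G u v × toℕ u < toℕ v

  size : ℕ
  size = length list

IsFES : ∀ {n} {G : Graph n} → EdgeSet G → Set
IsFES {n} {G} F = (C : Cycle G) →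
  ∃[ p ] ∃[ q ] ((p , q) ∈ Cycle.edges C ×
                 ((p , q) ∈ EdgeSet.list F ⊎ (q , p) ∈ EdgeSet.list F))

-- Planarity (via straight-line plane drawings with rational coordinates,
-- equivalent to planarity by Fáry's theorem)

Point : Set
Point = ℚ × ℚ

OnSeg : Point → Point → Point → Set
OnSeg (p₁ , p₂) (q₁ , q₂) x =
  ∃[ t ] (0ℚ ℚ.≤ t × t ℚ.≤ 1ℚ ×
          x ≡ (p₁ ℚ.+ t ℚ.* (q₁ ℚ.- p₁) , p₂ ℚ.+ t ℚ.* (q₂ ℚ.- p₂)))

SameEdge : ∀ {n} → Fin n → Fin n → Fin n → Fin n → Set
SameEdge u v w z = (u ≡ w × v ≡ z) ⊎ (u ≡ z × v ≡ w)

record PlaneDrawing {n : ℕ} (G : Graph n) : Set where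
  field
    pos       : Fin n → Point
    injective : ∀ u v → pos u ≡ pos v → u ≡ v
    avoid     : ∀ u v w → G u v → w ≢ u → w ≢ v → ¬ OnSeg (pos u) (pos v) (pos w)
    noCross   : ∀ u v w z → G u v → G w z → ¬ SameEdge u v w z →
                ∀ x → OnSeg (pos u) (pos v) x → OnSeg (pos w) (pos z) x →
                ∃[ c ] ((c ≡ u ⊎ c ≡ v) × (c ≡ w ⊎ c ≡ z) × x ≡ pos c)

Planar : ∀ {n} → Graph n → Set
Planar G = PlaneDrawing G

record Labeling {n : ℕ} (D : Digraph n) : Set where
  field
    lab     : Fin n → Fin n → List ℕ
    sym     : ∀ u v → lab u v ≡ lab v u
    uniq    : ∀ u v → Unique (lab u v)
    support : ∀ u v → ¬ Solid D u v → lab u v ≡ []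

data StrictWalk {n : ℕ} {D : Digraph n} (L : Labeling D)
     : Fin n → Fin n → ℕ → List (Fin n) → Set where
  stop : ∀ {u t} → StrictWalk L u u t [ u ]
  step : ∀ {u w v t t' ws} → t' ∈ Labeling.lab L u w → t ≤ t' →
         StrictWalk L w v (suc t') ws → StrictWalk L u v t (u ∷ ws)

StrictPath : ∀ {n} {D : Digraph n} → Labeling D → Fin n → Fin n → Set
StrictPath {n} L u v = ∃[ ws ] (StrictWalk L u v 0 ws × Unique ws)

Realizes : ∀ {n} (D : Digraph n) → Labeling D → Set
Realizes {n} D L = ∀ (u v : Fin n) → u ≢ v →
  (StrictPath L u v → Arc D u v) × (Arc D u v → StrictPath L u v)

Realizable : ∀ {n} → Digraph n → Set
Realizable D = Σ (Labeling D) (Realizes D)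

{-# OPTIONS --safe #-}
module Submission where

open import Defs
open import Data.Nat using (ℕ; _≤_; _+_; _*_)
open import Data.List using (length)
open import Data.Product using (Σ; ∃; ∃-syntax; _×_)

open import Data.Bool using (Bool; true; false; not; _xor_; if_then_else_)
import Data.Bool.Properties as Boolₚ
open import Data.Empty using (⊥; ⊥-elim)
open import Data.Fin as Fin using (Fin; zero; suc; toℕ; fromℕ<; combine; _↑ˡ_; _↑ʳ_; splitAt)
open import Data.Fin.Patterns using (0F; 1F)
import Data.Fin.Properties as Finₚ
open import Data.List using (List; []; _∷_; [_]; _++_; map; lookup; tabulate; upTo)
open import Data.List.Membership.Propositional using (_∈_)
open import Data.List.Membership.Propositional.Properties using (∈-lookup; ∈-map⁺; ∈-map⁻; ∈-++⁺ˡ; ∈-++⁺ʳ; ∈-++⁻; ∈-tabulate⁺; ∈-tabulate⁻; ∈-upTo⁺; ∈-upTo⁻)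
open import Data.List.Properties using (length-map; length-++; length-tabulate)
open import Data.List.Relation.Unary.All as All using (All; []; _∷_)
import Data.List.Relation.Unary.All.Properties as Allₚ
open import Data.List.Relation.Unary.AllPairs as AllPairs using (AllPairs)
open import Data.List.Relation.Unary.Any using (here; there; index)
open import Data.List.Relation.Unary.Any.Properties using (lookup-index)
open import Data.List.Relation.Unary.Linked using ([-]; _∷_)
open import Data.List.Relation.Unary.Unique.Propositional using (Unique)
import Data.List.Relation.Unary.Unique.Propositional.Properties as Uniqueₚ
open import Data.Nat using (zero; suc; _<_; _≤?_; z≤n; s≤s)
import Data.Nat.Properties as ℕₚ
open import Data.Nat.Tactic.RingSolver using (solve-∀)
open import Data.Product using (_,_; proj₁; proj₂)
open import Data.Rational as ℚ using (ℚ; 0ℚ; 1ℚ)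
import Data.Rational.Properties as ℚₚ
open import Data.Rational.Solver using (module +-*-Solver)
open import Data.Sum using (_⊎_; inj₁; inj₂; [_,_]′)
open import Data.Unit using (⊤; tt)
open import Function using (_∘_)
open import Relation.Binary.Definitions using (tri<; tri≈; tri>)
open import Relation.Binary.PropositionalEquality using (_≡_; _≢_; refl; sym; trans; cong; cong₂; subst; subst₂; module ≡-Reasoning)
open import Relation.Nullary using (¬_; Dec; yes; no; does)
open import Relation.Nullary.Decidable using (dec-true; dec-false; _×-dec_)

-- The digraph has two hubs, mid vertices 0, …, m-1 and a pendant leaf at each
-- mid vertex. The hubs are joined to each other and to all mid vertices, and
-- the only further arcs are those from mid i to mid j with i + 2 ≤ j.
--
-- Since leaf i is related to no hub, all labels between mid i and the hubs
-- coincide with the label of the edge to leaf i: mid i acts at a single time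
-- and attaches to one or both hubs. Neighbours i and i+1 are unrelated, so if
-- they share a hub their times agree; but the times of i and i+2 differ.
-- Hence among i, i+1, i+2 there is a mid vertex attached only to the first hub
-- and another attached only to the second. Picking from successive blocks of
-- four vertices attached to alternating hubs, each can reach the next only by
-- crossing the edge between the hubs at a time strictly between their times,
-- so that edge carries at least one label per pair of successive blocks.
--
-- Conversely mid i may act at time i+1 on the hub given by the parity of i,
-- with the edge between the hubs present at all times 0, …, m+1. The solid
-- graph is K_{2,m} with an edge between the hubs and pendant leaves; the
-- edge-disjoint 4-cycles through two mid vertices bound feedback edge sets.

does⁻¹ : ∀ {P : Set} (P? : Dec P) → does P? ≡ true → P
does⁻¹ (yes p) _ = p

-- The vertex set, its numbering and the digraph.

data Vertex (m : ℕ) : Set where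
  hub  : Bool → Vertex m
  mid  : Fin m → Vertex m
  leaf : Fin m → Vertex m

module Family (m : ℕ) where

  order : ℕ
  order = 2 + (m + m)

  encode : Vertex m → Fin order
  encode (hub false) = zero
  encode (hub true)  = suc zero
  encode (mid i)     = suc (suc (i ↑ˡ m))
  encode (leaf i)    = suc (suc (m ↑ʳ i))

  decode : Fin order → Vertex m
  decode zero          = hub false
  decode (suc zero)    = hub true
  decode (suc (suc x)) = [ mid , leaf ]′ (splitAt m x)

  decode-encode : ∀ a → decode (encode a) ≡ a
  decode-encode (hub false) = refl
  decode-encode (hub true)  = refl
  decode-encode (mid i)     = cong [ mid , leaf ]′ (Finₚ.splitAt-↑ˡ m i m)
  decode-encode (leaf i)    = cong [ mid , leaf ]′ (Finₚ.splitAt-↑ʳ m m i)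

  encode-decode : ∀ x → encode (decode x) ≡ x
  encode-decode zero          = refl
  encode-decode (suc zero)    = refl
  encode-decode (suc (suc x)) with splitAt m x in eq
  ... | inj₁ i = cong (λ y → suc (suc y)) (Finₚ.splitAt⁻¹-↑ˡ eq)
  ... | inj₂ i = cong (λ y → suc (suc y)) (Finₚ.splitAt⁻¹-↑ʳ {m} eq)

  encode-injective : ∀ {a b} → encode a ≡ encode b → a ≡ b
  encode-injective {a} {b} eq = trans (sym (decode-encode a)) (trans (cong decode eq) (decode-encode b))

  encode-unique : ∀ as → Unique as → Unique (map encode as)
  encode-unique _ = Uniqueₚ.map⁺ encode-injective

  decode-injective : ∀ {x y} → decode x ≡ decode y → x ≡ y
  decode-injective {x} {y} eq = trans (sym (encode-decode x)) (trans (cong encode eq) (encode-decode y))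

  mid-injective : ∀ {i j : Fin m} → mid i ≡ mid j → i ≡ j
  mid-injective refl = refl

  mid≢mid : ∀ {i j : Fin m} → 2 + toℕ i ≤ toℕ j → mid i ≢ mid j
  mid≢mid p refl = ℕₚ.<-asym p (ℕₚ.n<1+n _)

  arc : Vertex m → Vertex m → Bool
  arc (hub b)  (hub c)  = b xor c
  arc (hub _)  (mid _)  = true
  arc (hub _)  (leaf _) = false
  arc (mid _)  (hub _)  = true
  arc (mid i)  (mid j)  = does (2 + toℕ i ≤? toℕ j)
  arc (mid i)  (leaf j) = does (i Fin.≟ j)
  arc (leaf _) (hub _)  = false
  arc (leaf j) (mid i)  = does (i Fin.≟ j)
  arc (leaf _) (leaf _) = false

  data Adj : Vertex m → Vertex m → Set where
    rim     : ∀ b → Adj (hub b) (hub (not b))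
    spoke   : ∀ {b i} → Adj (hub b) (mid i)
    spoke˘  : ∀ {b i} → Adj (mid i) (hub b)
    thorn   : ∀ {i} → Adj (mid i) (leaf i)
    thorn˘  : ∀ {i} → Adj (leaf i) (mid i)

  -- Two mid vertices never have arcs both ways, since each such arc raises the index by at least
  -- two; all other arcs come in opposite pairs.
  arcs⇒Adj : ∀ {a b} → arc a b ≡ true → arc b a ≡ true → Adj a b
  arcs⇒Adj {hub true}  {hub false} _ _ = rim true
  arcs⇒Adj {hub false} {hub true}  _ _ = rim false
  arcs⇒Adj {hub _} {mid _} _ _ = spoke
  arcs⇒Adj {mid _} {hub _} _ _ = spoke˘
  arcs⇒Adj {mid i} {mid j} p q =
    ⊥-elim (ℕₚ.<-asym (ℕₚ.<-trans (ℕₚ.n<1+n _) (does⁻¹ (2 + toℕ i ≤? toℕ j) p))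
                      (ℕₚ.<-trans (ℕₚ.n<1+n _) (does⁻¹ (2 + toℕ j ≤? toℕ i) q)))
  arcs⇒Adj {mid i} {leaf j} p _ with does⁻¹ (i Fin.≟ j) p
  ... | refl = thorn
  arcs⇒Adj {leaf j} {mid i} p _ with does⁻¹ (i Fin.≟ j) p
  ... | refl = thorn˘

  Adj⇒arc : ∀ {a b} → Adj a b → arc a b ≡ true
  Adj⇒arc (rim false)     = refl
  Adj⇒arc (rim true)      = refl
  Adj⇒arc spoke           = refl
  Adj⇒arc spoke˘          = refl
  Adj⇒arc (thorn {i})     = dec-true (i Fin.≟ i) refl
  Adj⇒arc (thorn˘ {i})    = dec-true (i Fin.≟ i) refl

  Adj-sym : ∀ {a b} → Adj a b → Adj b a
  Adj-sym (rim false) = rim true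
  Adj-sym (rim true)  = rim false
  Adj-sym spoke       = spoke˘
  Adj-sym spoke˘      = spoke
  Adj-sym thorn       = thorn˘
  Adj-sym thorn˘      = thorn

  digraph : Digraph order
  digraph x y = arc (decode x) (decode y)

  digraph-simple : SimpleDigraph digraph
  digraph-simple x with decode x
  ... | hub false = refl
  ... | hub true  = refl
  ... | mid i     = dec-false (2 + toℕ i ≤? toℕ i) λ p → ℕₚ.<-asym p (ℕₚ.n<1+n _)
  ... | leaf _    = refl

  Solid⇒Adj : ∀ x y → Solid digraph x y → Adj (decode x) (decode y)
  Solid⇒Adj x y (p , q) = arcs⇒Adj p q

  Adj⇒Solid : ∀ {a b} → Adj a b → Solid digraph (encode a) (encode b)
  Adj⇒Solid {a} {b} e rewrite decode-encode a | decode-encode b = Adj⇒arc e , Adj⇒arc (Adj-sym e)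

  solid? : ∀ x y → Dec (Solid digraph x y)
  solid? x y = (digraph x y Boolₚ.≟ true) ×-dec (digraph y x Boolₚ.≟ true)

  decode≡⇒≡encode : ∀ {x a} → decode x ≡ a → encode a ≡ x
  decode≡⇒≡encode {x} eq = trans (cong encode (sym eq)) (encode-decode x)

  -- A leaf lies on no cycle, and the mid vertices are pairwise non-adjacent,
  -- so a hub occurs among any three consecutive vertices of a cycle.
  hubs-FVS : HasFVS2 (Solid digraph)
  hubs-FVS = encode (hub false) , encode (hub true) , (λ ()) , meets
    where
    hub-among : ∀ {x} {xs : List (Fin order)} {b} → decode x ≡ hub b → x ∈ xs →
                encode (hub false) ∈ xs ⊎ encode (hub true) ∈ xs
    hub-among {x} {b = false} eq x∈ = inj₁ (subst (_∈ _) (sym (decode≡⇒≡encode {x} eq)) x∈)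
    hub-among {x} {b = true}  eq x∈ = inj₂ (subst (_∈ _) (sym (decode≡⇒≡encode {x} eq)) x∈)

    three : ∀ {a b c} → Adj a b → Adj b c → a ≢ c → ∃[ h ] (a ≡ hub h ⊎ b ≡ hub h ⊎ c ≡ hub h)
    three (rim b) _       _   = b , inj₁ refl
    three spoke   _       _   = _ , inj₁ refl
    three spoke˘  _       _   = _ , inj₂ (inj₁ refl)
    three thorn   thorn˘  a≢c = ⊥-elim (a≢c refl)
    three thorn˘  spoke˘  _   = _ , inj₂ (inj₂ refl)
    three thorn˘  thorn   a≢c = ⊥-elim (a≢c refl)

    meets : (C : Cycle (Solid digraph)) →
            encode (hub false) ∈ Cycle.vertices C ⊎ encode (hub true) ∈ Cycle.vertices C
    meets record { rest = _ ∷ [] ; long = s≤s () }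
    meets record { start = x ; rest = y ∷ z ∷ _ ; uniq = (_ ∷ x≢z ∷ _) AllPairs.∷ _ ; linked = xy ∷ yz ∷ _ }
      with three (Solid⇒Adj x y xy) (Solid⇒Adj y z yz) (λ eq → x≢z (decode-injective eq))
    ... | _ , inj₁ eq        = hub-among {x} eq (here refl)
    ... | _ , inj₂ (inj₁ eq) = hub-among {y} eq (there (here refl))
    ... | _ , inj₂ (inj₂ eq) = hub-among {z} eq (there (there (here refl)))

  -- Enumeration of the solid edges, and feedback edge sets.

  data Edge : Set where
    rim   : Edge
    spoke : Bool → Fin m → Edge
    thorn : Fin m → Edge

  ends : Edge → Vertex m × Vertex m
  ends rim         = hub false , hub true
  ends (spoke b i) = hub b , mid i
  ends (thorn i)   = mid i , leaf i

  ends-injective : ∀ {e f} → ends e ≡ ends f → e ≡ f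
  ends-injective {rim}       {rim}       _    = refl
  ends-injective {spoke _ _} {spoke _ _} refl = refl
  ends-injective {thorn _}   {thorn _}   refl = refl

  ends-Adj : ∀ e → Adj (proj₁ (ends e)) (proj₂ (ends e))
  ends-Adj rim         = rim false
  ends-Adj (spoke _ _) = spoke
  ends-Adj (thorn _)   = thorn

  edgeOf : ∀ {a b} → Adj a b → ∃[ e ] (ends e ≡ (a , b) ⊎ ends e ≡ (b , a))
  edgeOf (rim false) = rim , inj₁ refl
  edgeOf (rim true)  = rim , inj₂ refl
  edgeOf spoke       = spoke _ _ , inj₁ refl
  edgeOf spoke˘      = spoke _ _ , inj₂ refl
  edgeOf thorn       = thorn _ , inj₁ refl
  edgeOf thorn˘      = thorn _ , inj₂ refl

  allEdges : List Edge
  allEdges = rim ∷ tabulate (spoke false) ++ tabulate (spoke true) ++ tabulate thorn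

  ∈-allEdges : ∀ e → e ∈ allEdges
  ∈-allEdges rim             = here refl
  ∈-allEdges (spoke false i) = there (∈-++⁺ˡ (∈-tabulate⁺ i))
  ∈-allEdges (spoke true i)  = there (∈-++⁺ʳ (tabulate (spoke false)) (∈-++⁺ˡ (∈-tabulate⁺ i)))
  ∈-allEdges (thorn i)       =
    there (∈-++⁺ʳ (tabulate (spoke false)) (∈-++⁺ʳ (tabulate (spoke true)) (∈-tabulate⁺ i)))

  allEdges-unique : Unique allEdges
  allEdges-unique =
    Allₚ.++⁺ (Allₚ.tabulate⁺ {f = spoke false} λ _ ())
      (Allₚ.++⁺ (Allₚ.tabulate⁺ {f = spoke true} λ _ ()) (Allₚ.tabulate⁺ {f = thorn} λ _ ()))
    AllPairs.∷ Uniqueₚ.++⁺ (Uniqueₚ.tabulate⁺ λ { refl → refl })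
        (Uniqueₚ.++⁺ (Uniqueₚ.tabulate⁺ λ { refl → refl }) (Uniqueₚ.tabulate⁺ λ { refl → refl }) spoke∦thorn)
        spoke∦rest
    where
    spoke∦thorn : ∀ {e} → ¬ (e ∈ tabulate (spoke true) × e ∈ tabulate thorn)
    spoke∦thorn (p , q) with ∈-tabulate⁻ p | ∈-tabulate⁻ q
    ... | _ , refl | _ , ()

    spoke∦rest : ∀ {e} → ¬ (e ∈ tabulate (spoke false) × e ∈ tabulate (spoke true) ++ tabulate thorn)
    spoke∦rest (p , q) with ∈-tabulate⁻ p | ∈-++⁻ (tabulate (spoke true)) q
    ... | _ , refl | inj₁ q′ with () ← proj₂ (∈-tabulate⁻ q′)
    ... | _ , refl | inj₂ q′ with () ← proj₂ (∈-tabulate⁻ q′)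

  encode² : Vertex m × Vertex m → Fin order × Fin order
  encode² (a , b) = encode a , encode b

  encodeEdge : Edge → Fin order × Fin order
  encodeEdge e = encode² (ends e)

  encodeEdge-injective : ∀ {e f} → encodeEdge e ≡ encodeEdge f → e ≡ f
  encodeEdge-injective {e} {f} eq = ends-injective
    (cong₂ _,_ (encode-injective (cong proj₁ eq)) (encode-injective (cong proj₂ eq)))

  encodeEdge-< : ∀ e → toℕ (proj₁ (encodeEdge e)) < toℕ (proj₂ (encodeEdge e))
  encodeEdge-< rim             = s≤s z≤n
  encodeEdge-< (spoke false i) = s≤s z≤n
  encodeEdge-< (spoke true i)  = s≤s (s≤s z≤n)
  encodeEdge-< (thorn i)       = s≤s (s≤s (begin-strict
    toℕ (i ↑ˡ m)  ≡⟨ Finₚ.toℕ-↑ˡ i m ⟩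
    toℕ i         <⟨ Finₚ.toℕ<n i ⟩
    m             ≤⟨ ℕₚ.m≤m+n m (toℕ i) ⟩
    m + toℕ i     ≡⟨ Finₚ.toℕ-↑ʳ m i ⟨
    toℕ (m ↑ʳ i)  ∎))
    where open ℕₚ.≤-Reasoning

  -- Taking every edge suffices for the upper bound on feedback edge sets, because the graph has
  -- only `3m + 1` edges.
  allEdgeSet : EdgeSet (Solid digraph)
  allEdgeSet = record
    { list  = map encodeEdge allEdges
    ; uniq  = Uniqueₚ.map⁺ encodeEdge-injective allEdges-unique
    ; valid = λ p → valid (∈-map⁻ encodeEdge p)
    }
    where
    valid : ∀ {x y} → ∃[ e ] (e ∈ allEdges × (x , y) ≡ encodeEdge e) → Solid digraph x y × toℕ x < toℕ y
    valid (e , _ , refl) = Adj⇒Solid (ends-Adj e) , encodeEdge-< e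

  allEdgeSet-size : EdgeSet.size allEdgeSet ≡ 1 + (m + (m + m))
  allEdgeSet-size
    rewrite length-map encodeEdge allEdges
          | length-++ (tabulate (spoke false)) {tabulate (spoke true) ++ tabulate thorn}
          | length-++ (tabulate (spoke true)) {tabulate thorn}
          | length-tabulate (Edge.spoke false) | length-tabulate (Edge.spoke true)
          | length-tabulate Edge.thorn = refl

  encodedEdge : ∀ x y → Solid digraph x y → ∃[ e ] (encodeEdge e ≡ (x , y) ⊎ encodeEdge e ≡ (y , x))
  encodedEdge x y s with edgeOf (Solid⇒Adj x y s)
  ... | e , inj₁ eq = e , inj₁ (trans (cong encode² eq) (cong₂ _,_ (encode-decode x) (encode-decode y)))
  ... | e , inj₂ eq = e , inj₂ (trans (cong encode² eq) (cong₂ _,_ (encode-decode y) (encode-decode x)))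

  allEdgeSet-FES : IsFES allEdgeSet
  allEdgeSet-FES record { rest = [] ; long = () }
  allEdgeSet-FES record { start = x ; rest = y ∷ _ ; linked = xy ∷ _ }
    with encodedEdge x y xy
  ... | e , inj₁ eq = x , y , here refl , inj₁ (subst (_∈ _) eq (∈-map⁺ encodeEdge (∈-allEdges e)))
  ... | e , inj₂ eq = x , y , here refl , inj₂ (subst (_∈ _) eq (∈-map⁺ encodeEdge (∈-allEdges e)))

  -- Squares on disjoint pairs of mid vertices share no edge, so each costs a feedback edge set an
  -- edge of its own.
  square : ∀ {i j : Fin m} → i ≢ j → Cycle (Solid digraph)
  square {i} {j} i≢j = record
    { start  = encode (hub false)
    ; rest   = map encode (mid i ∷ hub true ∷ mid j ∷ [])
    ; long   = s≤s (s≤s z≤n)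
    ; uniq   = encode-unique (hub false ∷ mid i ∷ hub true ∷ mid j ∷ [])
        (((λ ()) ∷ (λ ()) ∷ (λ ()) ∷ [])
         AllPairs.∷ ((λ ()) ∷ (λ eq → i≢j (mid-injective eq)) ∷ [])
         AllPairs.∷ ((λ ()) ∷ []) AllPairs.∷ [] AllPairs.∷ AllPairs.[])
    ; linked = Adj⇒Solid (spoke {false} {i}) ∷ Adj⇒Solid (spoke˘ {true} {i})
        ∷ Adj⇒Solid (spoke {true} {j}) ∷ Adj⇒Solid (spoke˘ {false} {j}) ∷ [-]
    }

  -- Both orientations are allowed, so that an edge of a cycle and its copy in an edge set need not
  -- be oriented alike.
  SpokeAt : Fin m → Fin order × Fin order → Set
  SpokeAt i p = ∃[ b ] (p ≡ (encode (hub b) , encode (mid i)) ⊎ p ≡ (encode (mid i) , encode (hub b)))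

  SpokeAt-functional : ∀ {i j p} → SpokeAt i p → SpokeAt j p → i ≡ j
  SpokeAt-functional (b , inj₁ refl) (c , inj₁ eq) = mid-injective (encode-injective (cong proj₂ eq))
  SpokeAt-functional (b , inj₁ refl) (c , inj₂ eq) with () ← encode-injective {hub b} {mid _} (cong proj₁ eq)
  SpokeAt-functional (b , inj₂ refl) (c , inj₁ eq) with () ← encode-injective {mid _} {hub c} (cong proj₁ eq)
  SpokeAt-functional (b , inj₂ refl) (c , inj₂ eq) = mid-injective (encode-injective (cong proj₁ eq))

  -- All four edges of the square are spokes, the first two at `mid i` and the last two at `mid j`.
  FES-meets-square : (F : EdgeSet (Solid digraph)) → IsFES F → ∀ {i j} → i ≢ j →
    ∃[ p ] (p ∈ EdgeSet.list F × (SpokeAt i p ⊎ SpokeAt j p))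
  FES-meets-square F fes i≢j with fes (square i≢j)
  ... | _ , _ , here refl , inj₁ p = _ , p , inj₁ (false , inj₁ refl)
  ... | _ , _ , here refl , inj₂ p = _ , p , inj₁ (false , inj₂ refl)
  ... | _ , _ , there (here refl) , inj₁ p = _ , p , inj₁ (true , inj₂ refl)
  ... | _ , _ , there (here refl) , inj₂ p = _ , p , inj₁ (true , inj₁ refl)
  ... | _ , _ , there (there (here refl)) , inj₁ p = _ , p , inj₂ (true , inj₁ refl)
  ... | _ , _ , there (there (here refl)) , inj₂ p = _ , p , inj₂ (true , inj₂ refl)
  ... | _ , _ , there (there (there (here refl))) , inj₁ p = _ , p , inj₂ (false , inj₂ refl)
  ... | _ , _ , there (there (there (here refl))) , inj₂ p = _ , p , inj₂ (false , inj₁ refl)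

-- Rational arithmetic and segments.

ι : ℕ → ℚ
ι zero    = 0ℚ
ι (suc k) = 1ℚ ℚ.+ ι k

ι-step : ∀ k → ι k ℚ.< ι (suc k)
ι-step k = subst (ℚ._< ι (suc k)) (ℚₚ.+-identityˡ (ι k)) (ℚₚ.+-monoˡ-< (ι k) (ℚₚ.positive⁻¹ 1ℚ))

ι-mono-< : ∀ {k l} → k < l → ι k ℚ.< ι l
ι-mono-< {k} {suc l} (s≤s k≤l) with ℕₚ.m≤n⇒m<n∨m≡n k≤l
... | inj₁ k<l  = ℚₚ.<-trans (ι-mono-< k<l) (ι-step l)
... | inj₂ refl = ι-step k

ι-cancel-≤ : ∀ {k l} → ι k ℚ.≤ ι l → k ≤ l
ι-cancel-≤ {k} {l} p = ℕₚ.≮⇒≥ λ l<k → ℚₚ.<⇒≢ (ℚₚ.<-≤-trans (ι-mono-< l<k) p) refl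

ι-injective : ∀ {k l} → ι k ≡ ι l → k ≡ l
ι-injective eq = ℕₚ.≤-antisym (ι-cancel-≤ (ℚₚ.≤-reflexive eq)) (ι-cancel-≤ (ℚₚ.≤-reflexive (sym eq)))

p≤q⇒0≤q-p : ∀ {p q} → p ℚ.≤ q → 0ℚ ℚ.≤ q ℚ.- p
p≤q⇒0≤q-p {p} {q} p≤q = subst (ℚ._≤ q ℚ.- p) (ℚₚ.+-inverseʳ p) (ℚₚ.+-monoˡ-≤ (ℚ.- p) p≤q)

OnSeg-start : ∀ p q → OnSeg p q p
OnSeg-start (p₁ , p₂) (q₁ , q₂) = 0ℚ , ℚₚ.≤-refl , ℚₚ.nonNegative⁻¹ 1ℚ , cong₂ _,_ (start p₁ q₁) (start p₂ q₂)
  where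
  open +-*-Solver
  start : ∀ p q → p ≡ p ℚ.+ 0ℚ ℚ.* (q ℚ.- p)
  start = solve 2 (λ p q → p := p :+ con 0ℚ :* (q :- p)) refl

OnSeg-sym : ∀ p q {x} → OnSeg p q x → OnSeg q p x
OnSeg-sym (p₁ , p₂) (q₁ , q₂) (t , 0≤t , t≤1 , refl) =
  1ℚ ℚ.- t , p≤q⇒0≤q-p t≤1
  , subst (1ℚ ℚ.- t ℚ.≤_) (ℚₚ.+-identityʳ 1ℚ) (ℚₚ.+-monoʳ-≤ 1ℚ (ℚₚ.neg-antimono-≤ 0≤t))
  , cong₂ _,_ (flip p₁ q₁ t) (flip p₂ q₂ t)
  where
  open +-*-Solver
  flip : ∀ p q t → p ℚ.+ t ℚ.* (q ℚ.- p) ≡ q ℚ.+ (1ℚ ℚ.- t) ℚ.* (p ℚ.- q)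
  flip = solve 3 (λ p q t → p :+ t :* (q :- p) := q :+ (con 1ℚ :- t) :* (p :- q)) refl

p-q≡0⇒p≡q : ∀ p q → p ℚ.- q ≡ 0ℚ → p ≡ q
p-q≡0⇒p≡q p q eq = begin
  p                ≡⟨ solve 2 (λ p q → p := (p :- q) :+ q) refl p q ⟩
  (p ℚ.- q) ℚ.+ q  ≡⟨ cong (ℚ._+ q) eq ⟩
  0ℚ ℚ.+ q         ≡⟨ ℚₚ.+-identityˡ q ⟩
  q                ∎
  where
  open ≡-Reasoning
  open +-*-Solver

both-signs : ∀ {y} → 0ℚ ℚ.≤ y → 0ℚ ℚ.≤ ℚ.- y → y ≡ 0ℚ
both-signs {y} 0≤y 0≤-y =
  ℚₚ.≤-antisym (subst (ℚ._≤ 0ℚ) (solve 1 (λ y → :- (:- y) := y) refl y) (ℚₚ.neg-antimono-≤ 0≤-y)) 0≤y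
  where open +-*-Solver

zero-product : ∀ p q → p ℚ.* q ≡ 0ℚ → p ≢ 0ℚ → q ≡ 0ℚ
zero-product p q pq≡0 p≢0 = begin
  q                      ≡⟨ ℚₚ.*-identityˡ q ⟨
  1ℚ ℚ.* q               ≡⟨ cong (ℚ._* q) (ℚₚ.*-inverseˡ p) ⟨
  ℚ.1/ p ℚ.* p ℚ.* q     ≡⟨ ℚₚ.*-assoc (ℚ.1/ p) p q ⟩
  ℚ.1/ p ℚ.* (p ℚ.* q)   ≡⟨ cong (ℚ.1/ p ℚ.*_) pq≡0 ⟩
  ℚ.1/ p ℚ.* 0ℚ          ≡⟨ ℚₚ.*-zeroʳ (ℚ.1/ p) ⟩
  0ℚ                     ∎
  where
  open ≡-Reasoning
  instance
    p-nonZero : ℚ.NonZero p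
    p-nonZero = ℚ.≢-nonZero p≢0

double-≤ : ∀ {k l} → k + k ≤ suc (l + l) → k ≤ l
double-≤ {k} {l} p = ℕₚ.≮⇒≥ λ l<k → ℕₚ.1+n≰n
  (ℕₚ.≤-trans (ℕₚ.≤-trans (ℕₚ.≤-reflexive (cong suc (sym (ℕₚ.+-suc l l)))) (ℕₚ.+-mono-≤ l<k l<k)) p)

-- A straight-line drawing

module Drawing (m : ℕ) where
  open Family m

  signed : Bool → ℚ → ℚ
  signed false y = ℚ.- y
  signed true  y = y

  -- Mid vertices take the odd columns and each leaf the even column after its mid vertex, while
  -- column 0 is left to the hubs. Thorns are thus disjoint unit intervals of the horizontal axis.
  col : Fin m → ℕ
  col i = suc (toℕ i + toℕ i)

  place : Vertex m → Point
  place (hub b)  = 0ℚ , signed b 1ℚ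
  place (mid i)  = ι (col i) , 0ℚ
  place (leaf i) = ι (suc (col i)) , 0ℚ

  -- The hypotheses say that the closed unit intervals starting at the two columns meet, and
  -- distinct columns are at least two apart.
  col-injective : ∀ {i j} → col i ≤ suc (col j) → col j ≤ suc (col i) → i ≡ j
  col-injective (s≤s p) (s≤s q) = Finₚ.toℕ-injective (ℕₚ.≤-antisym (double-≤ p) (double-≤ q))

  mid≢leaf : ∀ i j → col i ≢ suc (col j)
  mid≢leaf i j eq with col-injective {i} {j} (ℕₚ.≤-reflexive eq)
                         (ℕₚ.≤-trans (ℕₚ.n≤1+n _) (ℕₚ.≤-trans (ℕₚ.≤-reflexive (sym eq)) (ℕₚ.n≤1+n _)))
  ... | refl = ℕₚ.1+n≢n (sym eq)

  place-injective : ∀ {a b} → place a ≡ place b → a ≡ b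
  place-injective {hub false} {hub false} eq = refl
  place-injective {hub true}  {hub true}  eq = refl
  place-injective {hub false} {hub true}  eq with () ← cong proj₂ eq
  place-injective {hub true}  {hub false} eq with () ← cong proj₂ eq
  place-injective {hub _}     {mid j}     eq with () ← ι-injective {0} {col j} (cong proj₁ eq)
  place-injective {hub _}     {leaf j}    eq with () ← ι-injective {0} {suc (col j)} (cong proj₁ eq)
  place-injective {mid i}     {hub _}     eq with () ← ι-injective {col i} {0} (cong proj₁ eq)
  place-injective {leaf i}    {hub _}     eq with () ← ι-injective {suc (col i)} {0} (cong proj₁ eq)
  place-injective {mid i}     {mid j}     eq = cong mid (col-injective
    (ℕₚ.≤-trans (ℕₚ.≤-reflexive col≡) (ℕₚ.n≤1+n _)) (ℕₚ.≤-trans (ℕₚ.≤-reflexive (sym col≡)) (ℕₚ.n≤1+n _)))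
    where
    col≡ = ι-injective {col i} {col j} (cong proj₁ eq)
  place-injective {leaf i}    {leaf j}    eq = cong leaf (col-injective
    (ℕₚ.≤-trans (ℕₚ.n≤1+n _) (ℕₚ.≤-reflexive col≡)) (ℕₚ.≤-trans (ℕₚ.n≤1+n _) (ℕₚ.≤-reflexive (sym col≡))))
    where
    col≡ = ι-injective {suc (col i)} {suc (col j)} (cong proj₁ eq)
  place-injective {mid i}     {leaf j}    eq =
    ⊥-elim (mid≢leaf i j (ι-injective {col i} {suc (col j)} (cong proj₁ eq)))
  place-injective {leaf i}    {mid j}     eq =
    ⊥-elim (mid≢leaf j i (ι-injective {col j} {suc (col i)} (sym (cong proj₁ eq))))

  -- A convex region containing the edge, cut out by just enough of its
  -- defining (in)equalities to separate distinct edges.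
  Region : Edge → Point → Set
  Region rim         (x , y) = x ≡ 0ℚ
  Region (spoke b i) (x , y) = x ℚ.+ ι (col i) ℚ.* signed b y ≡ ι (col i) × 0ℚ ℚ.≤ signed b y
  Region (thorn i)   (x , y) = y ≡ 0ℚ × ι (col i) ℚ.≤ x × x ℚ.≤ ι (suc (col i))

  OnSeg⇒Region : ∀ e {x} → OnSeg (place (proj₁ (ends e))) (place (proj₂ (ends e))) x → Region e x
  OnSeg⇒Region rim (t , _ , _ , refl) =
    solve 1 (λ t → con 0ℚ :+ t :* (con 0ℚ :- con 0ℚ) := con 0ℚ) refl t
    where open +-*-Solver
  -- With `c = ι (col i)` this spoke consists of the points `(t c, 1 - t)`, on the line
  -- `x + c y = c`; the spoke to the other hub is its mirror image in the axis.
  OnSeg⇒Region (spoke true i) (t , _ , t≤1 , refl) =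
      solve 2 (λ c t → (con 0ℚ :+ t :* (c :- con 0ℚ)) :+ c :* (con 1ℚ :+ t :* (con 0ℚ :- con 1ℚ)) := c) refl
        (ι (col i)) t
    , subst (0ℚ ℚ.≤_) (solve 1 (λ t → con 1ℚ :- t := con 1ℚ :+ t :* (con 0ℚ :- con 1ℚ)) refl t) (p≤q⇒0≤q-p t≤1)
    where open +-*-Solver
  OnSeg⇒Region (spoke false i) (t , _ , t≤1 , refl) =
      solve 2 (λ c t → (con 0ℚ :+ t :* (c :- con 0ℚ))
                         :+ c :* (:- (con (ℚ.- 1ℚ) :+ t :* (con 0ℚ :- con (ℚ.- 1ℚ)))) := c) refl
        (ι (col i)) t
    , subst (0ℚ ℚ.≤_)
        (solve 1 (λ t → con 1ℚ :- t := :- (con (ℚ.- 1ℚ) :+ t :* (con 0ℚ :- con (ℚ.- 1ℚ)))) refl t)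
        (p≤q⇒0≤q-p t≤1)
    where open +-*-Solver
  OnSeg⇒Region (thorn i) (t , 0≤t , t≤1 , refl) =
      solve 1 (λ t → con 0ℚ :+ t :* (con 0ℚ :- con 0ℚ) := con 0ℚ) refl t
    , subst₂ ℚ._≤_ (ℚₚ.+-identityʳ _) eq (ℚₚ.+-monoʳ-≤ (ι (col i)) 0≤t)
    , subst₂ ℚ._≤_ eq (ℚₚ.+-comm (ι (col i)) 1ℚ) (ℚₚ.+-monoʳ-≤ (ι (col i)) t≤1)
    where
    open +-*-Solver
    eq : ι (col i) ℚ.+ t ≡ ι (col i) ℚ.+ t ℚ.* (ι (suc (col i)) ℚ.- ι (col i))
    -- `ι (suc (col i))` unfolds to `1ℚ ℚ.+ ι (col i)`, so a thorn has unit length and `t` is the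
    -- offset along it.
    eq = solve 2 (λ c t → c :+ t := c :+ t :* ((con 1ℚ :+ c) :- c)) refl (ι (col i)) t

  Common : Edge → Edge → Point → Set
  Common e f x = ∃[ c ] ((c ≡ proj₁ (ends e) ⊎ c ≡ proj₂ (ends e))
                       × (c ≡ proj₁ (ends f) ⊎ c ≡ proj₂ (ends f)) × x ≡ place c)

  Common-sym : ∀ {e f x} → Common e f x → Common f e x
  Common-sym (c , p , q , eq) = c , q , p , eq

  spoke-axis : ∀ b i {x y} → y ≡ 0ℚ → Region (spoke b i) (x , y) → x ≡ ι (col i)
  spoke-axis b i {x} refl (eq , _) = trans (sym (x+c*0≡x b)) eq
    where
    open +-*-Solver
    x+c*0≡x : ∀ b → x ℚ.+ ι (col i) ℚ.* signed b 0ℚ ≡ x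
    x+c*0≡x false = solve 2 (λ x c → x :+ c :* con 0ℚ := x) refl x (ι (col i))
    x+c*0≡x true  = solve 2 (λ x c → x :+ c :* con 0ℚ := x) refl x (ι (col i))

  unsign : ∀ b {y} → signed b y ≡ 1ℚ → y ≡ signed b 1ℚ
  unsign true  eq = eq
  unsign false eq = ℚₚ.neg-injective eq

  -- At `x = 0` the line equation reads `c Y = c` for the signed height `Y`, and `c` is nonzero
  -- because columns start at 1.
  spoke-rim : ∀ b i {y} → Region (spoke b i) (0ℚ , y) → y ≡ signed b 1ℚ
  spoke-rim b i {y} (eq , _) = unsign b
    (p-q≡0⇒p≡q (signed b y) 1ℚ (zero-product c (signed b y ℚ.- 1ℚ) c[Y-1]≡0 c≢0))
    where
    open ≡-Reasoning
    open +-*-Solver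
    c : ℚ
    c = ι (col i)

    c≢0 : c ≢ 0ℚ
    c≢0 c≡0 with () ← ι-injective {col i} {0} c≡0

    c[Y-1]≡0 : c ℚ.* (signed b y ℚ.- 1ℚ) ≡ 0ℚ
    c[Y-1]≡0 = begin
      c ℚ.* (signed b y ℚ.- 1ℚ)
        ≡⟨ solve 2 (λ c Y → c :* (Y :- con 1ℚ) := (con 0ℚ :+ c :* Y) :- c) refl c (signed b y) ⟩
      0ℚ ℚ.+ c ℚ.* signed b y ℚ.- c
        ≡⟨ cong (ℚ._- c) eq ⟩
      c ℚ.- c
        ≡⟨ ℚₚ.+-inverseʳ c ⟩
      0ℚ ∎

  -- Subtracting the two line equations gives `(c - d)(Y - 1) = 0`, and distinct spokes have
  -- distinct columns `c` and `d`.
  spokes-same-hub : ∀ b i j {x y} → i ≢ j → Region (spoke b i) (x , y) → Region (spoke b j) (x , y) →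
                    x ≡ 0ℚ × y ≡ signed b 1ℚ
  spokes-same-hub b i j {x} {y} i≢j (eq-i , _) (eq-j , _) = x≡0 , unsign b Y≡1
    where
    open ≡-Reasoning
    open +-*-Solver
    c d Y : ℚ
    c = ι (col i)
    d = ι (col j)
    Y = signed b y

    c-d≢0 : c ℚ.- d ≢ 0ℚ
    c-d≢0 eq = i≢j (mid-injective (place-injective (cong (_, 0ℚ) (p-q≡0⇒p≡q c d eq))))

    product : (c ℚ.- d) ℚ.* (Y ℚ.- 1ℚ) ≡ 0ℚ
    product = begin
      (c ℚ.- d) ℚ.* (Y ℚ.- 1ℚ)
        ≡⟨ solve 4 (λ c d x Y → (c :- d) :* (Y :- con 1ℚ)
                                 := ((x :+ c :* Y) :- (x :+ d :* Y)) :- (c :- d)) refl c d x Y ⟩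
      (x ℚ.+ c ℚ.* Y) ℚ.- (x ℚ.+ d ℚ.* Y) ℚ.- (c ℚ.- d)
        ≡⟨ cong₂ (λ p q → p ℚ.- q ℚ.- (c ℚ.- d)) eq-i eq-j ⟩
      c ℚ.- d ℚ.- (c ℚ.- d)
        ≡⟨ ℚₚ.+-inverseʳ (c ℚ.- d) ⟩
      0ℚ ∎

    Y≡1 : Y ≡ 1ℚ
    Y≡1 = p-q≡0⇒p≡q Y 1ℚ (zero-product (c ℚ.- d) (Y ℚ.- 1ℚ) product c-d≢0)

    x≡0 : x ≡ 0ℚ
    x≡0 = begin
      x                              ≡⟨ solve 2 (λ x c → x := (x :+ c :* con 1ℚ) :- c) refl x c ⟩
      x ℚ.+ c ℚ.* 1ℚ ℚ.- c           ≡⟨ cong (λ Y → x ℚ.+ c ℚ.* Y ℚ.- c) Y≡1 ⟨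
      x ℚ.+ c ℚ.* Y ℚ.- c            ≡⟨ cong (ℚ._- c) eq-i ⟩
      c ℚ.- c                        ≡⟨ ℚₚ.+-inverseʳ c ⟩
      0ℚ                             ∎

  intersect-rim-spoke : ∀ b i {x} → Region rim x → Region (spoke b i) x → Common rim (spoke b i) x
  intersect-rim-spoke b i refl r = hub b , rim-end b , inj₁ refl , cong (0ℚ ,_) (spoke-rim b i r)
    where
    rim-end : ∀ b → hub {m} b ≡ hub false ⊎ hub {m} b ≡ hub true
    rim-end false = inj₁ refl
    rim-end true  = inj₂ refl

  intersect-rim-thorn : ∀ i {x} → Region rim x → Region (thorn i) x → ⊥
  intersect-rim-thorn i refl (_ , c≤0 , _) with () ← ι-cancel-≤ {col i} {0} c≤0

  -- A spoke meets the axis only at its mid vertex, and the thorn's unit interval contains just one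
  -- odd column.
  intersect-spoke-thorn : ∀ b i j {x} → Region (spoke b i) x → Region (thorn j) x →
                          Common (spoke b i) (thorn j) x
  intersect-spoke-thorn b i j r (y≡0 , lo , hi) =
    mid i , inj₂ refl , inj₁ (cong mid i≡j) , cong₂ _,_ x≡c y≡0
    where
    x≡c = spoke-axis b i y≡0 r

    i≡j : i ≡ j
    i≡j = col-injective (ι-cancel-≤ {col i} {suc (col j)} (subst (ℚ._≤ ι (suc (col j))) x≡c hi))
      (ℕₚ.≤-trans (ι-cancel-≤ {col j} {col i} (subst (ι (col j) ℚ.≤_) x≡c lo)) (ℕₚ.n≤1+n _))

  -- The spokes lie in opposite closed half-planes, so a common point is on the axis, where each
  -- spoke has only its mid vertex.
  intersect-spokes : ∀ i j {x} → Region (spoke false i) x → Region (spoke true j) x →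
                     Common (spoke false i) (spoke true j) x
  intersect-spokes i j {x , y} r s = mid i , inj₂ refl , inj₂ (cong mid i≡j) , cong₂ _,_ x≡c y≡0
    where
    y≡0 = both-signs (proj₂ s) (proj₂ r)

    x≡c = spoke-axis false i y≡0 r

    i≡j : i ≡ j
    i≡j = mid-injective (place-injective (cong (_, 0ℚ) (trans (sym x≡c) (spoke-axis true j y≡0 s))))

  intersect : ∀ e f {x} → e ≢ f → Region e x → Region f x → Common e f x
  intersect rim         rim         e≢f r s = ⊥-elim (e≢f refl)
  intersect rim         (spoke b i) e≢f r s = intersect-rim-spoke b i r s
  intersect (spoke b i) rim         e≢f r s = Common-sym {rim} {spoke b i} (intersect-rim-spoke b i s r)
  intersect rim         (thorn i)   e≢f r s = ⊥-elim (intersect-rim-thorn i r s)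
  intersect (thorn i)   rim         e≢f r s = ⊥-elim (intersect-rim-thorn i s r)
  intersect (spoke b i) (thorn j)   e≢f r s = intersect-spoke-thorn b i j r s
  intersect (thorn j)   (spoke b i) e≢f r s = Common-sym {spoke b i} {thorn j} (intersect-spoke-thorn b i j s r)
  intersect (spoke false i) (spoke true j)  e≢f r s = intersect-spokes i j r s
  intersect (spoke true i)  (spoke false j) e≢f r s =
    Common-sym {spoke false j} {spoke true i} (intersect-spokes j i s r)
  intersect (spoke false i) (spoke false j) e≢f r s = hub false , inj₁ refl , inj₁ refl
    , (let x≡ , y≡ = spokes-same-hub false i j (e≢f ∘ cong (spoke false)) r s in cong₂ _,_ x≡ y≡)
  intersect (spoke true i) (spoke true j) e≢f r s = hub true , inj₁ refl , inj₁ refl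
    , (let x≡ , y≡ = spokes-same-hub true i j (e≢f ∘ cong (spoke true)) r s in cong₂ _,_ x≡ y≡)
  intersect (thorn i) (thorn j) e≢f (_ , lo , hi) (_ , lo′ , hi′) = ⊥-elim (e≢f (cong thorn
    (col-injective (ι-cancel-≤ {col i} {suc (col j)} (ℚₚ.≤-trans lo hi′))
                   (ι-cancel-≤ {col j} {suc (col i)} (ℚₚ.≤-trans lo′ hi)))))

  pos : Fin order → Point
  pos x = place (decode x)

  Joins : Edge → Fin order → Fin order → Set
  Joins e x y = ends e ≡ (decode x , decode y) ⊎ ends e ≡ (decode y , decode x)

  OnSeg⇒Region′ : ∀ e {x y p} → Joins e x y →
                  OnSeg (pos x) (pos y) p → Region e p
  OnSeg⇒Region′ e {p = p} (inj₁ eq) seg =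
    OnSeg⇒Region e (subst (λ (a , b) → OnSeg (place a) (place b) p) (sym eq) seg)
  OnSeg⇒Region′ e {x} {y} {p} (inj₂ eq) seg =
    OnSeg⇒Region e (subst (λ (a , b) → OnSeg (place a) (place b) p) (sym eq) (OnSeg-sym (pos x) (pos y) seg))

  endpoint : ∀ e {c x y} → Joins e x y →
             c ≡ proj₁ (ends e) ⊎ c ≡ proj₂ (ends e) → encode c ≡ x ⊎ encode c ≡ y
  endpoint e {x = x} {y} (inj₁ eq) (inj₁ refl) = inj₁ (decode≡⇒≡encode {x} (sym (cong proj₁ eq)))
  endpoint e {x = x} {y} (inj₁ eq) (inj₂ refl) = inj₂ (decode≡⇒≡encode {y} (sym (cong proj₂ eq)))
  endpoint e {x = x} {y} (inj₂ eq) (inj₁ refl) = inj₂ (decode≡⇒≡encode {y} (sym (cong proj₁ eq)))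
  endpoint e {x = x} {y} (inj₂ eq) (inj₂ refl) = inj₁ (decode≡⇒≡encode {x} (sym (cong proj₂ eq)))

  same-ends : ∀ e {x y w z} → Joins e x y →
              Joins e w z → SameEdge x y w z
  same-ends e (inj₁ p) (inj₁ q) = let r = trans (sym p) q in
    inj₁ (decode-injective (cong proj₁ r) , decode-injective (cong proj₂ r))
  same-ends e (inj₁ p) (inj₂ q) = let r = trans (sym p) q in
    inj₂ (decode-injective (cong proj₁ r) , decode-injective (cong proj₂ r))
  same-ends e (inj₂ p) (inj₁ q) = let r = trans (sym p) q in
    inj₂ (decode-injective (cong proj₂ r) , decode-injective (cong proj₁ r))
  same-ends e (inj₂ p) (inj₂ q) = let r = trans (sym p) q in
    inj₁ (decode-injective (cong proj₂ r) , decode-injective (cong proj₁ r))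

  noCross : ∀ x y w z → Solid digraph x y → Solid digraph w z → ¬ SameEdge x y w z →
            ∀ p → OnSeg (pos x) (pos y) p → OnSeg (pos w) (pos z) p →
            ∃[ c ] ((c ≡ x ⊎ c ≡ y) × (c ≡ w ⊎ c ≡ z) × p ≡ pos c)
  noCross x y w z xy wz xy≢wz p on-xy on-wz =
    let e , e-ends = edgeOf (Solid⇒Adj x y xy)
        f , f-ends = edgeOf (Solid⇒Adj w z wz)
        c , c∈e , c∈f , eq = intersect e f
          (λ e≡f → xy≢wz (same-ends e {x} {y} {w} {z} e-ends
                           (subst (λ e → Joins e w z) (sym e≡f) f-ends)))
          (OnSeg⇒Region′ e {x} {y} e-ends on-xy) (OnSeg⇒Region′ f {w} {z} f-ends on-wz)
    in encode c , endpoint e {c} {x} {y} e-ends c∈e , endpoint f {c} {w} {z} f-ends c∈f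
       , trans eq (cong place (sym (decode-encode c)))

  neighbour : ∀ a → ∃[ b ] Adj a b
  neighbour (hub b)  = hub (not b) , rim b
  neighbour (mid i)  = leaf i , thorn
  neighbour (leaf i) = mid i , thorn˘

  pos-injective : ∀ x y → pos x ≡ pos y → x ≡ y
  pos-injective x y = decode-injective ∘ place-injective

  -- No vertex is isolated, so a vertex inside an edge would give a crossing of two edges.
  avoid : ∀ x y w → Solid digraph x y → w ≢ x → w ≢ y → ¬ OnSeg (pos x) (pos y) (pos w)
  avoid x y w xy w≢x w≢y on-xy =
    let b , wb = neighbour (decode w)
        c , c∈xy , _ , eq = noCross x y w (encode b) xy
          (subst (λ w → Solid digraph w (encode b)) (encode-decode w) (Adj⇒Solid wb))
          (λ { (inj₁ (x≡w , _)) → w≢x (sym x≡w) ; (inj₂ (_ , y≡w)) → w≢y (sym y≡w) })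
          (pos w) on-xy (OnSeg-start (pos w) (pos (encode b)))
        w≡c = pos-injective w c eq
    in [ (λ c≡x → w≢x (trans w≡c c≡x)) , (λ c≡y → w≢y (trans w≡c c≡y)) ]′ c∈xy

  planar : Planar (Solid digraph)
  planar = record
    { pos = pos ; injective = pos-injective ; avoid = avoid ; noCross = noCross }

-- A realization

module Walks (m : ℕ) where
  open Family m

  -- Strict walks over `Vertex` and an arbitrary label function, so that the same type serves the
  -- explicit schedule and an unknown labeling.
  data Walk (ℓ : Vertex m → Vertex m → List ℕ) : Vertex m → Vertex m → ℕ → List (Vertex m) → Set where
    stop : ∀ {a t} → Walk ℓ a a t [ a ]
    step : ∀ {a b c t s as} → s ∈ ℓ a b → t ≤ s → Walk ℓ b c (suc s) as → Walk ℓ a c t (a ∷ as)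

  labels : Labeling digraph → Vertex m → Vertex m → List ℕ
  labels L a b = Labeling.lab L (encode a) (encode b)

  labels-decode : ∀ L x y → labels L (decode x) (decode y) ≡ Labeling.lab L x y
  labels-decode L x y = cong₂ (Labeling.lab L) (encode-decode x) (encode-decode y)

  decodeWalk : ∀ L {x y t xs} → StrictWalk L x y t xs → Walk (labels L) (decode x) (decode y) t (map decode xs)
  decodeWalk L stop = stop
  decodeWalk L (step {u = x} {w = y} s∈ t≤s W) =
    step (subst (_ ∈_) (sym (labels-decode L x y)) s∈) t≤s (decodeWalk L W)

  encodeWalk : ∀ L {a b t as} → Walk (labels L) a b t as → StrictWalk L (encode a) (encode b) t (map encode as)
  encodeWalk L stop              = stop
  encodeWalk L (step s∈ t≤s W) = step s∈ t≤s (encodeWalk L W)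

  mapWalk : ∀ {ℓ ℓ′} → (∀ {a b t} → t ∈ ℓ a b → t ∈ ℓ′ a b) →
            ∀ {a b t as} → Walk ℓ a b t as → Walk ℓ′ a b t as
  mapWalk f stop              = stop
  mapWalk f (step s∈ t≤s W) = step (f s∈) t≤s (mapWalk f W)

  Path : (Vertex m → Vertex m → List ℕ) → Vertex m → Vertex m → Set
  Path ℓ a b = ∃[ as ] (Walk ℓ a b 0 as × Unique as)

  encodePath : ∀ L {a b} → Path (labels L) a b → StrictPath L (encode a) (encode b)
  encodePath L (as , W , u) = map encode as , encodeWalk L W , encode-unique as u

module Realization (m : ℕ) where
  open Family m
  open Walks m

  side : ℕ → Bool
  side zero    = false
  side (suc k) = not (side k)

  at : ∀ {P : Set} → Dec P → Fin m → List ℕ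
  at P? i = if does P? then [ suc (toℕ i) ] else []

  schedule : Vertex m → Vertex m → List ℕ
  -- Spokes act at times 1 to `m`; label 0 allows a crossing before all of them and label `m + 1`
  -- one after all of them.
  schedule (hub b)  (hub c)  = if b xor c then upTo (2 + m) else []
  schedule (hub b)  (mid i)  = at (b Boolₚ.≟ side (toℕ i)) i
  schedule (mid i)  (hub b)  = at (b Boolₚ.≟ side (toℕ i)) i
  schedule (mid i)  (leaf j) = at (i Fin.≟ j) i
  schedule (leaf j) (mid i)  = at (i Fin.≟ j) i
  schedule (hub _)  (leaf _) = []
  schedule (mid _)  (mid _)  = []
  schedule (leaf _) (hub _)  = []
  schedule (leaf _) (leaf _) = []

  schedule-sym : ∀ a b → schedule a b ≡ schedule b a
  schedule-sym (hub b)  (hub c)  rewrite Boolₚ.xor-comm b c = refl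
  schedule-sym (hub _)  (mid _)  = refl
  schedule-sym (hub _)  (leaf _) = refl
  schedule-sym (mid _)  (hub _)  = refl
  schedule-sym (mid _)  (mid _)  = refl
  schedule-sym (mid _)  (leaf _) = refl
  schedule-sym (leaf _) (hub _)  = refl
  schedule-sym (leaf _) (mid _)  = refl
  schedule-sym (leaf _) (leaf _) = refl

  at-unique : ∀ {P : Set} (P? : Dec P) i → Unique (at P? i)
  at-unique P? i with does P?
  ... | true  = [] AllPairs.∷ AllPairs.[]
  ... | false = AllPairs.[]

  schedule-unique : ∀ a b → Unique (schedule a b)
  schedule-unique (hub b)  (hub c) with b xor c
  ... | true  = Uniqueₚ.upTo⁺ (2 + m)
  ... | false = AllPairs.[]
  schedule-unique (hub b)  (mid i)  = at-unique (b Boolₚ.≟ side (toℕ i)) i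
  schedule-unique (mid i)  (hub b)  = at-unique (b Boolₚ.≟ side (toℕ i)) i
  schedule-unique (mid i)  (leaf j) = at-unique (i Fin.≟ j) i
  schedule-unique (leaf j) (mid i)  = at-unique (i Fin.≟ j) i
  schedule-unique (hub _)  (leaf _) = AllPairs.[]
  schedule-unique (mid _)  (mid _)  = AllPairs.[]
  schedule-unique (leaf _) (hub _)  = AllPairs.[]
  schedule-unique (leaf _) (leaf _) = AllPairs.[]

  -- The scheduled moves as an indexed family, so that matching on a move fixes both its ends and,
  -- except for a crossing, its time.
  data Event : Vertex m → Vertex m → ℕ → Set where
    cross  : ∀ b {t} → t < 2 + m → Event (hub b) (hub (not b)) t
    arrive : ∀ i → Event (hub (side (toℕ i))) (mid i) (suc (toℕ i))
    depart : ∀ i → Event (mid i) (hub (side (toℕ i))) (suc (toℕ i))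
    climb  : ∀ i → Event (mid i) (leaf i) (suc (toℕ i))
    fall   : ∀ i → Event (leaf i) (mid i) (suc (toℕ i))

  ∈-at⁻ : ∀ {P : Set} (P? : Dec P) i {t} → t ∈ at P? i → P × t ≡ suc (toℕ i)
  ∈-at⁻ (yes p) i (here eq) = p , eq

  ∈-at⁺ : ∀ {P : Set} (P? : Dec P) i → P → suc (toℕ i) ∈ at P? i
  ∈-at⁺ (yes _) i _ = here refl
  ∈-at⁺ (no ¬p) i p = ⊥-elim (¬p p)

  event : ∀ a b {t} → t ∈ schedule a b → Event a b t
  event (hub true)  (hub false) t∈ = cross true (∈-upTo⁻ t∈)
  event (hub false) (hub true)  t∈ = cross false (∈-upTo⁻ t∈)
  event (hub b) (mid i) t∈ with ∈-at⁻ (b Boolₚ.≟ side (toℕ i)) i t∈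
  ... | refl , refl = arrive i
  event (mid i) (hub b) t∈ with ∈-at⁻ (b Boolₚ.≟ side (toℕ i)) i t∈
  ... | refl , refl = depart i
  event (mid i) (leaf j) t∈ with ∈-at⁻ (i Fin.≟ j) i t∈
  ... | refl , refl = climb i
  event (leaf j) (mid i) t∈ with ∈-at⁻ (i Fin.≟ j) i t∈
  ... | refl , refl = fall i

  scheduled : ∀ {a b t} → Event a b t → t ∈ schedule a b
  scheduled (cross false t<) = ∈-upTo⁺ t<
  scheduled (cross true t<)  = ∈-upTo⁺ t<
  scheduled (arrive i)       = ∈-at⁺ (side (toℕ i) Boolₚ.≟ side (toℕ i)) i refl
  scheduled (depart i)       = ∈-at⁺ (side (toℕ i) Boolₚ.≟ side (toℕ i)) i refl
  scheduled (climb i)        = ∈-at⁺ (i Fin.≟ i) i refl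
  scheduled (fall i)         = ∈-at⁺ (i Fin.≟ i) i refl

  Event⇒Adj : ∀ {a b t} → Event a b t → Adj a b
  Event⇒Adj (cross b _) = rim b
  Event⇒Adj (arrive _)  = spoke
  Event⇒Adj (depart _)  = spoke˘
  Event⇒Adj (climb _)   = thorn
  Event⇒Adj (fall _)    = thorn˘

  delay : Bool → Bool → ℕ
  delay b c = if b xor c then 1 else 0

  -- Over-approximates "b can be reached from a by moves at times ≥ t";
  -- crossing to the other hub costs one unit of time.
  Reaches : Vertex m → ℕ → Vertex m → Set
  Reaches (hub _)  t (hub _)  = ⊤
  Reaches (hub b)  t (mid j)  = delay b (side (toℕ j)) + t ≤ suc (toℕ j)
  Reaches (hub _)  t (leaf _) = ⊥
  Reaches (mid i)  t (hub _)  = t ≤ suc (toℕ i)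
  Reaches (mid i)  t (mid j)  = i ≡ j ⊎ (t ≤ suc (toℕ i) × 2 + toℕ i ≤ toℕ j)
  Reaches (mid i)  t (leaf j) = i ≡ j × t ≤ suc (toℕ i)
  Reaches (leaf _) t (hub _)  = ⊥
  Reaches (leaf i) t (mid j)  = i ≡ j
  Reaches (leaf i) t (leaf j) = i ≡ j

  delay-self : ∀ b → delay b b ≡ 0
  delay-self false = refl
  delay-self true  = refl

  delay-not : ∀ b → delay b (not b) ≡ 1
  delay-not false = refl
  delay-not true  = refl

  delay≤1 : ∀ b c → delay b c ≤ 1
  delay≤1 false false = z≤n
  delay≤1 false true  = s≤s z≤n
  delay≤1 true  false = s≤s z≤n
  delay≤1 true  true  = z≤n

  -- The time unit spent on the crossing pays for the delay, which is at most one.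
  cross-≤ : ∀ b c {t s k} → t ≤ s → delay (not b) c + suc s ≤ k → delay b c + t ≤ k
  cross-≤ b c {t} {s} {k} t≤s p = begin
    delay b c + t            ≤⟨ ℕₚ.+-mono-≤ (delay≤1 b c) t≤s ⟩
    suc s                    ≤⟨ ℕₚ.m≤n+m (suc s) (delay (not b) c) ⟩
    delay (not b) c + suc s  ≤⟨ p ⟩
    k                        ∎
    where open ℕₚ.≤-Reasoning

  -- Consecutive indices lie on different sides.
  depart-≤ : ∀ i j → delay (side i) (side j) + (2 + i) ≤ suc j → 2 + i ≤ j
  depart-≤ i j p with ℕₚ.m≤n⇒m<n∨m≡n
                        (ℕₚ.≤-pred (ℕₚ.≤-trans (ℕₚ.m≤n+m (2 + i) (delay (side i) (side j))) p))
  ... | inj₁ q    = q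
  ... | inj₂ refl rewrite delay-not (side i) = ⊥-elim (ℕₚ.1+n≰n p)

  Reaches-refl : ∀ a t → Reaches a t a
  Reaches-refl (hub _)  t = tt
  Reaches-refl (mid _)  t = inj₁ refl
  Reaches-refl (leaf _) t = refl

  -- `Reaches` is preserved on prepending a move. All moves at `mid i` happen at time `i + 1`, so a
  -- walk that has just entered `mid i` cannot leave it again; the corresponding cases are absurd.
  Reaches-step : ∀ {a b t s} c → Event a b s → t ≤ s → Reaches b (suc s) c → Reaches a t c
  Reaches-step (hub _)  (cross _ _) t≤s r = tt
  Reaches-step (mid j)  (cross b _) t≤s r = cross-≤ b (side (toℕ j)) t≤s r
  Reaches-step (hub _)  (arrive i)  t≤s r = tt
  Reaches-step (mid j)  (arrive i)  t≤s (inj₁ refl) rewrite delay-self (side (toℕ i)) = t≤s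
  Reaches-step (mid j)  (arrive i)  t≤s (inj₂ (p , _)) = ⊥-elim (ℕₚ.1+n≰n p)
  Reaches-step (leaf j) (arrive i)  t≤s (_ , p) = ⊥-elim (ℕₚ.1+n≰n p)
  Reaches-step (hub _)  (depart i)  t≤s r = t≤s
  Reaches-step (mid j)  (depart i)  t≤s r = inj₂ (t≤s , depart-≤ (toℕ i) (toℕ j) r)
  Reaches-step (mid j)  (climb i)   t≤s r = inj₁ r
  Reaches-step (leaf j) (climb i)   t≤s r = r , t≤s
  Reaches-step (hub _)  (fall i)    t≤s r = ℕₚ.1+n≰n r
  Reaches-step (mid j)  (fall i)    t≤s (inj₁ eq) = eq
  Reaches-step (mid j)  (fall i)    t≤s (inj₂ (p , _)) = ⊥-elim (ℕₚ.1+n≰n p)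
  Reaches-step (leaf j) (fall i)    t≤s r = proj₁ r

  Walk⇒Reaches : ∀ {a b t as} → Walk schedule a b t as → Reaches a t b
  Walk⇒Reaches {a} {t = t} stop = Reaches-refl a t
  Walk⇒Reaches {a} {c} (step {b = b} s∈ t≤s W) =
    Reaches-step c (event a b s∈) t≤s (Walk⇒Reaches W)

  Reaches⇒arc : ∀ a b → a ≢ b → Reaches a 0 b → arc a b ≡ true
  Reaches⇒arc (hub true)  (hub true)  a≢b _ = ⊥-elim (a≢b refl)
  Reaches⇒arc (hub true)  (hub false) a≢b _ = refl
  Reaches⇒arc (hub false) (hub true)  a≢b _ = refl
  Reaches⇒arc (hub false) (hub false) a≢b _ = ⊥-elim (a≢b refl)
  Reaches⇒arc (hub _)  (mid _)  _   _              = refl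
  Reaches⇒arc (mid _)  (hub _)  _   _              = refl
  Reaches⇒arc (mid i)  (mid j)  a≢b (inj₁ refl)    = ⊥-elim (a≢b refl)
  Reaches⇒arc (mid i)  (mid j)  _   (inj₂ (_ , p)) = dec-true (2 + toℕ i ≤? toℕ j) p
  Reaches⇒arc (mid i)  (leaf j) _   (p , _)        = dec-true (i Fin.≟ j) p
  Reaches⇒arc (leaf i) (mid j)  _   p              = dec-true (j Fin.≟ i) (sym p)
  Reaches⇒arc (leaf i) (leaf j) a≢b refl           = ⊥-elim (a≢b refl)

  _◅_ : ∀ {a b c t s as} → Event a b s × t ≤ s → Walk schedule b c (suc s) as → Walk schedule a c t (a ∷ as)
  (e , t≤s) ◅ W = step (scheduled e) t≤s W

  infixr 5 _◅_

  hub≢hub : ∀ {b} → hub {m} b ≢ hub (not b)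
  hub≢hub {false} ()
  hub≢hub {true}  ()

  hub-path : ∀ b → Path schedule (hub b) (hub (not b))
  hub-path b = _ , (cross b (s≤s z≤n) , z≤n) ◅ stop
             , (hub≢hub ∷ []) AllPairs.∷ [] AllPairs.∷ AllPairs.[]

  arc⇒Path : ∀ a b → arc a b ≡ true → Path schedule a b
  arc⇒Path (hub true)  (hub false) _ = hub-path true
  arc⇒Path (hub false) (hub true)  _ = hub-path false
  arc⇒Path (hub b) (mid i) _ with side (toℕ i) Boolₚ.≟ b
  ... | yes refl = _ , (arrive i , z≤n) ◅ stop
                 , ((λ ()) ∷ []) AllPairs.∷ [] AllPairs.∷ AllPairs.[]
  ... | no side≢b = _ , (cross b (s≤s z≤n) , z≤n)
                     ◅ subst Arrive (Boolₚ.¬-not side≢b) ((arrive i , s≤s z≤n) ◅ stop)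
                 , (hub≢hub ∷ (λ ()) ∷ [])
                   AllPairs.∷ ((λ ()) ∷ []) AllPairs.∷ [] AllPairs.∷ AllPairs.[]
    where
    Arrive : Bool → Set
    Arrive c = Walk schedule (hub c) (mid i) 1 (hub c ∷ mid i ∷ [])
  arc⇒Path (mid i) (hub b) _ with side (toℕ i) Boolₚ.≟ b
  ... | yes refl = _ , (depart i , z≤n) ◅ stop
                 , ((λ ()) ∷ []) AllPairs.∷ [] AllPairs.∷ AllPairs.[]
  ... | no side≢b with Boolₚ.¬-not (side≢b ∘ sym)
  ...   | refl = _ , (depart i , z≤n) ◅ (cross _ (s≤s (s≤s (Finₚ.toℕ<n i))) , ℕₚ.≤-refl) ◅ stop
                 , ((λ ()) ∷ (λ ()) ∷ [])
                   AllPairs.∷ (hub≢hub ∷ [])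
                   AllPairs.∷ [] AllPairs.∷ AllPairs.[]
  arc⇒Path (mid i) (mid j) i⇒j
    with does⁻¹ (2 + toℕ i ≤? toℕ j) i⇒j | side (toℕ i) Boolₚ.≟ side (toℕ j)
  ... | 2+i≤j | yes eq =
      _ , (depart i , z≤n) ◅ subst Arrive (sym eq) ((arrive j , s≤s (ℕₚ.<⇒≤ 2+i≤j)) ◅ stop)
    , ((λ ()) ∷ mid≢mid 2+i≤j ∷ []) AllPairs.∷ ((λ ()) ∷ []) AllPairs.∷ [] AllPairs.∷ AllPairs.[]
    where
    Arrive : Bool → Set
    Arrive c = Walk schedule (hub c) (mid j) (2 + toℕ i) (hub c ∷ mid j ∷ [])
  -- Departure at `i + 1`, crossing at `i + 2` and arrival at `j + 1` are strictly increasing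
  -- exactly when `2 + i ≤ j`.
  ... | 2+i≤j | no neq =
      _ , (depart i , z≤n) ◅ (cross _ (s≤s (s≤s (Finₚ.toℕ<n i))) , ℕₚ.≤-refl)
        ◅ subst Arrive (Boolₚ.¬-not (neq ∘ sym)) ((arrive j , s≤s 2+i≤j) ◅ stop)
    , ((λ ()) ∷ (λ ()) ∷ mid≢mid 2+i≤j ∷ [])
      AllPairs.∷ (hub≢hub ∷ (λ ()) ∷ [])
      AllPairs.∷ ((λ ()) ∷ []) AllPairs.∷ [] AllPairs.∷ AllPairs.[]
    where
    Arrive : Bool → Set
    Arrive c = Walk schedule (hub c) (mid j) (3 + toℕ i) (hub c ∷ mid j ∷ [])
  arc⇒Path (mid i) (leaf j) i⇒j with does⁻¹ (i Fin.≟ j) i⇒j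
  ... | refl = _ , (climb i , z≤n) ◅ stop , ((λ ()) ∷ []) AllPairs.∷ [] AllPairs.∷ AllPairs.[]
  arc⇒Path (leaf j) (mid i) j⇒i with does⁻¹ (i Fin.≟ j) j⇒i
  ... | refl = _ , (fall i , z≤n) ◅ stop , ((λ ()) ∷ []) AllPairs.∷ [] AllPairs.∷ AllPairs.[]

  labeling : Labeling digraph
  labeling = record
    { lab     = λ x y → schedule (decode x) (decode y)
    ; sym     = λ x y → schedule-sym (decode x) (decode y)
    ; uniq    = λ x y → schedule-unique (decode x) (decode y)
    ; support = λ x y → support (decode x) (decode y)
    }
    where
    support : ∀ a b → ¬ (arc a b ≡ true × arc b a ≡ true) → schedule a b ≡ []
    support a b ¬ab with schedule a b in eq
    ... | []    = refl
    ... | t ∷ _ = ⊥-elim (¬ab (Adj⇒arc ab , Adj⇒arc (Adj-sym ab)))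
      where
      ab : Adj a b
      ab = Event⇒Adj (event a b (subst (t ∈_) (sym eq) (here refl)))

  labels-labeling : ∀ a b → labels labeling a b ≡ schedule a b
  labels-labeling a b = cong₂ schedule (decode-encode a) (decode-encode b)

  realizes : Realizes digraph labeling
  realizes x y x≢y = sound , complete
    where
    sound : StrictPath labeling x y → Arc digraph x y
    sound (_ , W , _) = Reaches⇒arc (decode x) (decode y) (x≢y ∘ decode-injective)
      (Walk⇒Reaches (mapWalk (λ {a} {b} → subst (_ ∈_) (labels-labeling a b)) (decodeWalk labeling W)))

    complete : Arc digraph x y → StrictPath labeling x y
    complete x⇒y with arc⇒Path (decode x) (decode y) x⇒y
    ... | as , W , u = subst₂ (StrictPath labeling) (encode-decode x) (encode-decode y)
      (encodePath labeling (as , mapWalk (λ {a} {b} → subst (_ ∈_) (sym (labels-labeling a b))) W , u))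

  realizable : Realizable digraph
  realizable = labeling , realizes

-- Lower bounds

-- Pigeonhole on the positions given by the membership proofs: equal positions hold equal entries.
injective-∈⇒≤ : ∀ {A : Set} {k} {xs : List A} (f : Fin k → A) →
  (∀ {i j} → f i ≡ f j → i ≡ j) → (∀ i → f i ∈ xs) → k ≤ length xs
injective-∈⇒≤ {xs = xs} f f-injective f∈ = Finₚ.injective⇒≤ {f = index ∘ f∈} λ {i} {j} eq →
  f-injective (trans (lookup-index (f∈ i)) (trans (cong (lookup xs) eq) (sym (lookup-index (f∈ j)))))

lookup-injective : ∀ {A : Set} {xs : List A} → Unique xs → ∀ {i j} → lookup xs i ≡ lookup xs j → i ≡ j
lookup-injective (x∉ AllPairs.∷ u) {zero}  {zero}  eq = refl
lookup-injective (x∉ AllPairs.∷ u) {zero}  {suc j} eq = ⊥-elim (All.lookup x∉ (∈-lookup j) eq)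
lookup-injective (x∉ AllPairs.∷ u) {suc i} {zero}  eq = ⊥-elim (All.lookup x∉ (∈-lookup i) (sym eq))
lookup-injective (x∉ AllPairs.∷ u) {suc i} {suc j} eq = cong suc (lookup-injective u eq)

Unique-⊆⇒length≤ : ∀ {A : Set} {xs ys : List A} → Unique ys → All (_∈ xs) ys → length ys ≤ length xs
Unique-⊆⇒length≤ {ys = ys} u ys⊆xs =
  injective-∈⇒≤ (lookup ys) (lookup-injective u) (λ i → All.lookup ys⊆xs (∈-lookup i))

-- An arbitrary realization, read on `Vertex` instead of `Fin order`.

module VertexLabels (m : ℕ) (L : Labeling (Family.digraph m)) (realizes : Realizes (Family.digraph m) L) where
  open Family m
  open Walks m

  labels-sym : ∀ a b {t} → t ∈ labels L a b → t ∈ labels L b a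
  labels-sym a b = subst (_ ∈_) (Labeling.sym L (encode a) (encode b))

  ∈-labels⇒Adj : ∀ a b {t} → t ∈ labels L a b → Adj a b
  ∈-labels⇒Adj a b t∈ with solid? (encode a) (encode b)
  ... | yes s = subst₂ Adj (decode-encode a) (decode-encode b) (Solid⇒Adj (encode a) (encode b) s)
  ... | no ¬s with () ← subst (_ ∈_) (Labeling.support L (encode a) (encode b) ¬s) t∈

  Path⇒arc : ∀ a b → a ≢ b → Path (labels L) a b → arc a b ≡ true
  Path⇒arc a b a≢b P = subst₂ (λ a b → arc a b ≡ true) (decode-encode a) (decode-encode b)
    (proj₁ (realizes (encode a) (encode b) (a≢b ∘ encode-injective)) (encodePath L P))

  arc⇒Walk : ∀ a b → a ≢ b → arc a b ≡ true → ∃[ as ] Walk (labels L) a b 0 as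
  arc⇒Walk a b a≢b a⇒b
    with proj₂ (realizes (encode a) (encode b) (a≢b ∘ encode-injective))
           (subst₂ (λ a b → arc a b ≡ true) (sym (decode-encode a)) (sym (decode-encode b)) a⇒b)
  ... | _ , W , _ =
    _ , subst₂ (λ a b → Walk (labels L) a b 0 _) (decode-encode a) (decode-encode b) (decodeWalk L W)

-- Labels forced on the edge between the hubs.

module LowerBound
  (m : ℕ) (ℓ : Vertex m → Vertex m → List ℕ)
  (ℓ-sym    : ∀ {a b t} → t ∈ ℓ a b → t ∈ ℓ b a)
  (∈ℓ⇒Adj   : ∀ {a b t} → t ∈ ℓ a b → Family.Adj m a b)
  (Path⇒arc : ∀ {a b} → a ≢ b → Walks.Path m ℓ a b → Family.arc m a b ≡ true)
  (arc⇒Walk : ∀ {a b} → a ≢ b → Family.arc m a b ≡ true → ∃[ as ] Walks.Walk m ℓ a b 0 as)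
  where
  open Family m
  open Walks m

  -- The main use is contrapositive: where the arc from `a` to `c` is missing, the label on the
  -- first edge cannot precede that on the second.
  two-steps : ∀ {a b c s t} → a ≢ b → a ≢ c → b ≢ c →
              s ∈ ℓ a b → t ∈ ℓ b c → s < t → arc a c ≡ true
  two-steps a≢b a≢c b≢c s∈ t∈ s<t = Path⇒arc a≢c
    (_ , step s∈ z≤n (step t∈ s<t stop)
       , (a≢b ∷ a≢c ∷ []) AllPairs.∷ (b≢c ∷ []) AllPairs.∷ [] AllPairs.∷ AllPairs.[])

  -- The only neighbour of a leaf is its mid vertex, so a walk that enters the leaf does so along
  -- the thorn.
  last-label : ∀ {a i t as} → a ≢ leaf i → Walk ℓ a (leaf i) t as → ∃[ s ] s ∈ ℓ (mid i) (leaf i)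
  last-label a≢ stop = ⊥-elim (a≢ refl)
  last-label a≢ (step {b = hub _} _ _ W) = last-label (λ ()) W
  last-label a≢ (step {b = mid _} _ _ W) = last-label (λ ()) W
  last-label {i = i} a≢ (step {b = leaf j} s∈ _ W) with j Fin.≟ i | ∈ℓ⇒Adj s∈
  ... | yes refl | thorn = _ , s∈
  ... | no j≢i   | _     = last-label (λ { refl → j≢i refl }) W

  thorn-label : ∀ i → ∃[ s ] s ∈ ℓ (mid i) (leaf i)
  thorn-label i = last-label {mid i} (λ ()) (proj₂ (arc⇒Walk (λ ()) (Adj⇒arc (thorn {i}))))

  -- One label of the thorn; by `spoke-label`, every label of a spoke at `mid i` equals it.
  time : Fin m → ℕ
  time i = proj₁ (thorn-label i)

  -- The leaf at mid i neither reaches nor is reached from a hub, so no spoke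
  -- at mid i has a label before or after that of the thorn.
  spoke-label : ∀ {i b t} → t ∈ ℓ (mid i) (hub b) → t ≡ time i
  spoke-label {i} {b} {t} t∈ with ℕₚ.<-cmp t (time i)
  ... | tri≈ _ eq _ = eq
  ... | tri< t< _ _ with () ← two-steps {hub b} (λ ()) (λ ()) (λ ()) (ℓ-sym t∈) (proj₂ (thorn-label i)) t<
  ... | tri> _ _ t> with () ← two-steps {leaf i} {c = hub b} (λ ()) (λ ()) (λ ())
                                (ℓ-sym (proj₂ (thorn-label i))) t∈ t>

  On : Fin m → Bool → Set
  On i b = time i ∈ ℓ (mid i) (hub b)

  -- Normal form of a walk from a hub to `mid j` starting no earlier than `t`: it arrives directly,
  -- or after a single crossing at time `s`.
  FromHub : Bool → ℕ → Fin m → Set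
  FromHub b t j = (On j b × t ≤ time j)
    ⊎ (∃[ s ] (s ∈ ℓ (hub b) (hub (not b)) × t ≤ s × s < time j × On j (not b)))

  FromMid : Fin m → ℕ → Fin m → Set
  FromMid i t j = i ≡ j ⊎ (∃[ b ] (On i b × t ≤ time i × FromHub b (suc (time i)) j))

  From : Vertex m → ℕ → Fin m → Set
  From (hub b)  = FromHub b
  From (mid i)  = FromMid i
  -- A walk from a leaf to a mid vertex has to start along the thorn.
  From (leaf i) = FromMid i

  FromMid-weaken : ∀ {i j s t} → t ≤ s → FromMid i (suc s) j → FromMid i t j
  FromMid-weaken t≤s (inj₁ eq) = inj₁ eq
  FromMid-weaken t≤s (inj₂ (b , on , s< , h)) = inj₂ (b , on , ℕₚ.≤-trans t≤s (ℕₚ.<⇒≤ s<) , h)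

  Walk⇒From : ∀ {a j t as} → Walk ℓ a (mid j) t as → From a t j
  Walk⇒From stop = inj₁ refl
  Walk⇒From (step s∈ t≤s W) with ∈ℓ⇒Adj s∈ | Walk⇒From W
  ... | rim b  | inj₁ (on , s<)                = inj₂ (_ , s∈ , t≤s , s< , on)
  ... | rim b  | inj₂ (r , _ , s<r , r< , on)  =
    inj₁ (subst (On _) (Boolₚ.not-involutive b) on , ℕₚ.≤-trans t≤s (ℕₚ.<⇒≤ (ℕₚ.<-trans s<r r<)))
  ... | spoke {i = i} | h with spoke-label (ℓ-sym s∈) | h
  ...   | refl | inj₁ refl                = inj₁ (ℓ-sym s∈ , t≤s)
  ...   | refl | inj₂ (_ , _ , s< , _)    = ⊥-elim (ℕₚ.1+n≰n s<)
  Walk⇒From (step s∈ t≤s W) | spoke˘ | h with spoke-label s∈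
  ... | refl = inj₂ (_ , s∈ , t≤s , h)
  Walk⇒From (step s∈ t≤s W) | thorn  | h = FromMid-weaken t≤s h
  Walk⇒From (step s∈ t≤s W) | thorn˘ | h = FromMid-weaken t≤s h

  mid-link : ∀ {i j} → 2 + toℕ i ≤ toℕ j → ∃[ b ] (On i b × FromHub b (suc (time i)) j)
  mid-link {i} {j} i≪j
    with Walk⇒From (proj₂ (arc⇒Walk (mid≢mid i≪j) (dec-true (2 + toℕ i ≤? toℕ j) i≪j)))
  ... | inj₁ refl             = ⊥-elim (mid≢mid i≪j refl)
  ... | inj₂ (b , on , _ , h) = b , on , h

  time-mono : ∀ {i j} → 2 + toℕ i ≤ toℕ j → time i < time j
  time-mono i≪j with mid-link i≪j
  ... | _ , _ , inj₁ (_ , i<j)             = i<j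
  ... | _ , _ , inj₂ (_ , _ , i<s , s<j , _) = ℕₚ.<-trans i<s s<j

  -- The shared hub gives a strict path from `mid i` to `mid j`, hence an arc, and arcs between mid
  -- vertices need this gap.
  meet⇒≪ : ∀ {i j b} → i ≢ j → On i b → On j b → time i < time j → 2 + toℕ i ≤ toℕ j
  meet⇒≪ {i} {j} i≢j on-i on-j i<j = does⁻¹ (2 + toℕ i ≤? toℕ j)
    (two-steps {mid i} {c = mid j} (λ ()) (i≢j ∘ mid-injective) (λ ()) on-i (ℓ-sym on-j) i<j)

  successors-meet : ∀ {i j b} → toℕ j ≡ suc (toℕ i) → On i b → On j b → time i ≡ time j
  successors-meet {i} {j} j≡1+i on-i on-j with ℕₚ.<-cmp (time i) (time j)
  ... | tri≈ _ eq _ = eq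
  ... | tri< i<j _ _ = ⊥-elim (ℕₚ.1+n≰n (subst (2 + toℕ i ≤_) j≡1+i (meet⇒≪ i≢j on-i on-j i<j)))
    where
    i≢j : i ≢ j
    i≢j refl = ℕₚ.1+n≢n (sym j≡1+i)
  ... | tri> _ _ j<i = ⊥-elim (ℕₚ.<-asym (ℕₚ.n<1+n _)
      (ℕₚ.<⇒≤ (subst (λ k → 2 + k ≤ toℕ i) j≡1+i (meet⇒≪ j≢i on-j on-i j<i))))
    where
    j≢i : j ≢ i
    j≢i refl = ℕₚ.1+n≢n (sym j≡1+i)

  OnlyOn : Fin m → Bool → Set
  OnlyOn i b = On i b × ¬ On i (not b)

  -- With only two hubs and none shared, each of the two mid vertices is on exactly one hub, and
  -- these hubs differ.
  separate : ∀ {i j} → (∀ {b} → On i b → ¬ On j b) → ∃[ b ] On i b → ∃[ b ] On j b →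
             ∀ b → OnlyOn i b ⊎ OnlyOn j b
  separate {i} {j} disjoint (c , on-i) (d , on-j) b with c Boolₚ.≟ b | d Boolₚ.≟ b
  ... | yes refl | yes refl = ⊥-elim (disjoint on-i on-j)
  ... | yes refl | no d≢b   = inj₁ (on-i , λ on → disjoint on (subst (On j) (Boolₚ.¬-not d≢b) on-j))
  ... | no c≢b   | yes refl = inj₂ (on-j , λ on → disjoint (subst (On i) (Boolₚ.¬-not c≢b) on-i) on)
  ... | no c≢b   | no d≢b   = ⊥-elim (disjoint on-i
                                (subst (On j) (trans (Boolₚ.¬-not d≢b) (sym (Boolₚ.¬-not c≢b))) on-j))

  -- The times of k and k+2 differ, so that of k+1 differs from one of them.
  some-OnlyOn : ∀ {k} → 3 + k < m → ∀ b → ∃[ x ] (k ≤ toℕ x × toℕ x ≤ 2 + k × OnlyOn x b)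
  some-OnlyOn {k} 3+k<m b = cases (time x₀ ℕₚ.≟ time x₁)
    where
    2+k<m : 2 + k < m
    2+k<m = ℕₚ.<-trans (ℕₚ.n<1+n _) 3+k<m

    1+k<m : 1 + k < m
    1+k<m = ℕₚ.<-trans (ℕₚ.n<1+n _) 2+k<m

    k<m : k < m
    k<m = ℕₚ.<-trans (ℕₚ.n<1+n _) 1+k<m

    x₀ x₁ x₂ x₃ : Fin m
    x₀ = fromℕ< k<m
    x₁ = fromℕ< 1+k<m
    x₂ = fromℕ< 2+k<m
    x₃ = fromℕ< 3+k<m

    toℕ-x₀ : toℕ x₀ ≡ k
    toℕ-x₀ = Finₚ.toℕ-fromℕ< k<m

    toℕ-x₁ : toℕ x₁ ≡ 1 + k
    toℕ-x₁ = Finₚ.toℕ-fromℕ< 1+k<m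

    toℕ-x₂ : toℕ x₂ ≡ 2 + k
    toℕ-x₂ = Finₚ.toℕ-fromℕ< 2+k<m

    x₁≡1+x₀ : toℕ x₁ ≡ suc (toℕ x₀)
    x₁≡1+x₀ = trans toℕ-x₁ (cong suc (sym toℕ-x₀))

    x₂≡1+x₁ : toℕ x₂ ≡ suc (toℕ x₁)
    x₂≡1+x₁ = trans toℕ-x₂ (cong suc (sym toℕ-x₁))

    x₀≪x₂ : 2 + toℕ x₀ ≤ toℕ x₂
    x₀≪x₂ = ℕₚ.≤-reflexive (trans (cong (2 +_) toℕ-x₀) (sym toℕ-x₂))

    x₁≪x₃ : 2 + toℕ x₁ ≤ toℕ x₃
    x₁≪x₃ = ℕₚ.≤-reflexive (trans (cong (2 +_) toℕ-x₁) (sym (Finₚ.toℕ-fromℕ< 3+k<m)))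

    on-x₀ : ∃[ c ] On x₀ c
    on-x₀ = let c , on , _ = mid-link x₀≪x₂ in c , on

    -- The fourth vertex of the block provides an arc out of `x₁`, which must leave through some
    -- hub.
    on-x₁ : ∃[ c ] On x₁ c
    on-x₁ = let c , on , _ = mid-link x₁≪x₃ in c , on

    on-x₂ : ∃[ c ] On x₂ c
    on-x₂ with mid-link x₀≪x₂
    ... | c , _ , inj₁ (on , _)             = c , on
    ... | c , _ , inj₂ (_ , _ , _ , _ , on) = not c , on

    within : ∀ {x d} → toℕ x ≡ d + k → d ≤ 2 → OnlyOn x b →
             ∃[ x ] (k ≤ toℕ x × toℕ x ≤ 2 + k × OnlyOn x b)
    within {x} {d} eq d≤2 o = x , subst (k ≤_) (sym eq) (ℕₚ.m≤n+m k d)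
                                , subst (_≤ 2 + k) (sym eq) (ℕₚ.+-monoˡ-≤ k d≤2) , o

    cases : Dec (time x₀ ≡ time x₁) → ∃[ x ] (k ≤ toℕ x × toℕ x ≤ 2 + k × OnlyOn x b)
    cases (no t₀≢t₁) with separate (λ o₀ o₁ → t₀≢t₁ (successors-meet x₁≡1+x₀ o₀ o₁)) on-x₀ on-x₁ b
    ... | inj₁ o = within toℕ-x₀ z≤n o
    ... | inj₂ o = within toℕ-x₁ (s≤s z≤n) o
    cases (yes t₀≡t₁)
      with separate (λ o₁ o₂ → ℕₚ.<⇒≢ (time-mono x₀≪x₂) (trans t₀≡t₁ (successors-meet x₂≡1+x₁ o₁ o₂)))
                    on-x₁ on-x₂ b
    ... | inj₁ o = within toℕ-x₁ (s≤s z≤n) o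
    ... | inj₂ o = within toℕ-x₂ ℕₚ.≤-refl o

  rim-false : ∀ b {t} → t ∈ ℓ (hub b) (hub (not b)) → t ∈ ℓ (hub false) (hub true)
  rim-false false t∈ = t∈
  rim-false true  t∈ = ℓ-sym t∈

  -- The walk must leave `x` towards one hub and enter `y` from the other, so its normal form
  -- contains a crossing.
  label-between : ∀ {x y b} → 2 + toℕ x ≤ toℕ y → OnlyOn x b → OnlyOn y (not b) →
                  ∃[ t ] (t ∈ ℓ (hub false) (hub true) × time x < t × t < time y)
  label-between {x} {y} {b} x≪y (_ , x∌) (_ , y∌) with mid-link x≪y
  ... | c , on-x , h with c Boolₚ.≟ b
  ...   | no c≢b = ⊥-elim (x∌ (subst (On x) (Boolₚ.¬-not c≢b) on-x))
  ...   | yes refl with h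
  ...     | inj₁ (on-y , _)            = ⊥-elim (y∌ (subst (On y) (sym (Boolₚ.not-involutive b)) on-y))
  ...     | inj₂ (t , t∈ , x<t , t<y , _) = t , rim-false b t∈ , x<t , t<y

  -- Induction on the number of remaining blocks, swapping the hub at each. The bound `time x <_` is
  -- carried along to place the new label, which precedes `time y`, before all later ones.
  label-chain : ∀ j k → 3 + (k + j * 4) < m → ∀ {x b} → toℕ x ≤ 2 + k → OnlyOn x b →
    ∃[ ts ] (length ts ≡ j × AllPairs _<_ ts × All (time x <_) ts × All (_∈ ℓ (hub false) (hub true)) ts)
  label-chain zero    k _ _ _ = [] , refl , AllPairs.[] , [] , []
  label-chain (suc j) k <m {x} {b} x≤ o
    = let y , lo , hi , o′ = some-OnlyOn 7+k<m (not b)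
          -- Blocks start four apart while picks lie within three consecutive indices, so
          -- `x ≤ 2 + k` and `4 + k ≤ y` leave the required gap of two.
          t , t∈ , x<t , t<y = label-between (ℕₚ.≤-trans (ℕₚ.+-monoʳ-≤ 2 x≤) lo) o o′
          ts , len , incr , y< , ts⊆ = label-chain j (4 + k) <m′ hi o′
      in t ∷ ts , cong suc len , All.map (ℕₚ.<-trans t<y) y< AllPairs.∷ incr
         , x<t ∷ All.map (ℕₚ.<-trans (ℕₚ.<-trans x<t t<y)) y< , t∈ ∷ ts⊆
    where
    <m′ : 3 + (4 + k + j * 4) < m
    <m′ = subst (λ n → 3 + n < m)
      (sym (trans (cong (_+ j * 4) (ℕₚ.+-comm 4 k)) (ℕₚ.+-assoc k 4 (j * 4)))) <m

    7+k<m : 3 + (4 + k) < m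
    7+k<m = ℕₚ.≤-<-trans (ℕₚ.+-monoʳ-≤ 3 (ℕₚ.m≤m+n (4 + k) (j * 4))) <m′

  rim-labels : ∀ j → 3 + j * 4 < m → j ≤ length (ℓ (hub false) (hub true))
  rim-labels j <m =
    let _ , _ , hi , o = some-OnlyOn (ℕₚ.≤-<-trans (ℕₚ.m≤m+n 3 (j * 4)) <m) false
        ts , len , incr , _ , ts⊆ = label-chain j 0 <m hi o
    in subst (_≤ _) len (Unique-⊆⇒length≤ (AllPairs.map ℕₚ.<⇒≢ incr) ts⊆)

-- Lower bound on feedback edge sets.

module Blocks (K : ℕ) where
  open Family (K * 4)

  -- One square is taken per block of four mid vertices, on the first two of them. The edge of `F`
  -- found there is a spoke whose mid vertex reveals the block, so different blocks give different
  -- edges.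
  FES-size : (F : EdgeSet (Solid digraph)) → IsFES F → K ≤ EdgeSet.size F
  FES-size F fes = injective-∈⇒≤ edge (λ {k} {l} → edge-injective {k} {l}) (λ k → proj₁ (proj₂ (edge∈ k)))
    where
    0≢1 : (k : Fin K) → combine {n = 4} k 0F ≢ combine k 1F
    0≢1 k eq with () ← Finₚ.combine-injectiveʳ k 0F k 1F eq

    edge∈ : ∀ k → ∃[ p ] (p ∈ EdgeSet.list F × (SpokeAt (combine k 0F) p ⊎ SpokeAt (combine k 1F) p))
    edge∈ k = FES-meets-square F fes (0≢1 k)

    edge : Fin K → Fin order × Fin order
    edge k = proj₁ (edge∈ k)

    block : ∀ k → ∃[ r ] SpokeAt (combine k r) (edge k)
    block k with proj₂ (proj₂ (edge∈ k))
    ... | inj₁ s = 0F , s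
    ... | inj₂ s = 1F , s

    edge-injective : ∀ {k l} → edge k ≡ edge l → k ≡ l
    edge-injective {k} {l} eq with block k | block l
    ... | r , s | r′ , s′ =
      Finₚ.combine-injectiveˡ k r l r′ (SpokeAt-functional s (subst (SpokeAt _) (sym eq) s′))

-- Arithmetic of the constants and conclusion.

8K+2 : ∀ K → 2 + (K * 4 + K * 4) ≡ 8 * K + 2
8K+2 = solve-∀

8N+10 : ∀ N → 2 + ((4 + N * 4) + (4 + N * 4)) ≡ 8 * N + 10
8N+10 = solve-∀

-- The last summand is the slack between `8n + 10`, for order `n`, and the number of edges.
edge-slack : ∀ m → 8 * (2 + (m + m)) + 10 ≡ 1 + (m + (m + m)) + (25 + 13 * m)
edge-slack = solve-∀

rim-label-count : ∀ N (L : Labeling (Family.digraph (4 + N * 4))) → Realizes (Family.digraph (4 + N * 4)) L →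
  N ≤ length (Walks.labels (4 + N * 4) L (hub false) (hub true))
-- `4 + N * 4` is the least `m` with `3 + N * 4 < m`.
rim-label-count N L realizes = rim-labels N ℕₚ.≤-refl
  where
  open VertexLabels (4 + N * 4) L realizes
  open LowerBound (4 + N * 4) (Walks.labels (4 + N * 4) L)
    (λ {a} {b} → labels-sym a b) (λ {a} {b} → ∈-labels⇒Adj a b)
    (λ {a} {b} → Path⇒arc a b) (λ {a} {b} → arc⇒Walk a b)

theorem4 : ∃[ a ] ∃[ b ] ((N : ℕ) → ∃[ n ] (N ≤ n × Σ (Digraph n) λ D →
    SimpleDigraph D
    × Planar (Solid D)
    × HasFVS2 (Solid D)
    × (Σ (EdgeSet (Solid D)) λ F → IsFES F × EdgeSet.size F ≤ a * n + b)
    × ((F : EdgeSet (Solid D)) → IsFES F → n ≤ a * EdgeSet.size F + b)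
    × Realizable D
    × ∃[ u ] ∃[ v ] (Solid D u v ×
    ((L : Labeling D) → Realizes D L →
    n ≤ a * length (Labeling.lab L u v) + b))))
-- The order is `8N + 10`, and the edge between the hubs carries at least `N` labels; the same
-- constants cover both bounds on feedback edge sets, whose size is at least `N + 1`.
theorem4 = 8 , 10 , λ N →
  let m = 4 + N * 4
      open Family m
  in order
   , ℕₚ.≤-trans (ℕₚ.m≤m*n N 4) (ℕₚ.≤-trans (ℕₚ.m≤n+m (N * 4) 6) (ℕₚ.m≤m+n (2 + m) m))
   , digraph
   , digraph-simple
   , Drawing.planar m
   , hubs-FVS
   , (allEdgeSet , allEdgeSet-FES
     , ℕₚ.≤-trans (ℕₚ.≤-reflexive allEdgeSet-size)
         (ℕₚ.≤-trans (ℕₚ.m≤m+n _ (25 + 13 * m)) (ℕₚ.≤-reflexive (sym (edge-slack m)))))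
   , (λ F fes → ℕₚ.≤-trans (ℕₚ.≤-reflexive (8K+2 (suc N)))
       (ℕₚ.+-mono-≤ (ℕₚ.*-monoʳ-≤ 8 (Blocks.FES-size (suc N) F fes)) (ℕₚ.m≤m+n 2 8)))
   , Realization.realizable m
   , encode (hub false) , encode (hub true)
   , Adj⇒Solid (rim false)
   , λ L realizes → ℕₚ.≤-trans (ℕₚ.≤-reflexive (8N+10 N))
       (ℕₚ.+-monoˡ-≤ 10 (ℕₚ.*-monoʳ-≤ 8 (rim-label-count N L realizes)))
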